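{- Let $f$ be a supersymmetric function, i.e. $f\in\Gamma$. Then $$\mathbb{E}_n[f]=\sum_{\lambda\in\mathcal{SP}_n}\frac{2^{n-\ell(\lambda)}(g^\lambda)^2}{n!}\,f(\lambda_1,\lambda_2,\dots,\lambda_{\ell(\lambda)})$$ is a polynomial function in $n$: there is a polynomial $\Phi_f$ such that $\mathbb{E}_n[f]=\Phi_f(n)$ for all integers $n\ge 0$.
   Context: A partition is a finite weakly decreasing sequence $\lambda=(\lambda_1,\dots,\lambda_l)$ of positive integers; $\ell(\lambda)=l$ is its length and $|\lambda|=\sum_i\lambda_i$ its size. It is strict if all parts are distinct. $\mathcal{SP}_n$ denotes the set of strict partitions of $n$ (with $\mathcal{SP}_0=\{\emptyset\}$). The shifted Young diagram of a strict $\lambda$ is $S(\lambda)=\{(i,j)\in\mathbb{Z}^2: 1\le i\le\ell(\lambda),\ i\le j\le\lambda_i+i-1\}$. $g^\lambda$ is the number of sequences $\emptyset=\lambda^{(0)},\lambda^{(1)},\dots,\lambda^{(|\lambda|)}=\lambda$ of strict partitions such that each $S(\lambda^{(i)})$ is obtained from $S(\lambda^{(i-1)})$ by adding exactly one box. $p_r=x_1^r+x_2^r+\cdots$ denotes the $r$-th power-sum symmetric function, and $\Gamma$ is the subalgebra (over $\mathbb{Q}$) of the algebra of symmetric functions generated by $p_1,p_3,p_5,\dots$; its elements are called supersymmetric functions. For $f\in\Gamma$ and a strict partition $\lambda$, $f(\lambda_1,\dots,\lambda_{\ell(\lambda)})$ means $f$ evaluated at $x_i=\lambda_i$ for $i\le\ell(\lambda)$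 and $x_i=0$ for $i>\ell(\lambda)$. -}

module Defs where

open import Data.Bool using (Bool; true; false; if_then_else_; _∧_)
open import Data.Nat as ℕ using (ℕ; zero; suc; _≡ᵇ_; _≤ᵇ_; _!; _∸_)
open import Data.Nat.Properties using (_!≢0)
open import Data.Integer using (+_)
open import Data.List using (List; []; _∷_; map; _++_; length; upTo)
open import Data.Bool.ListAction using (all; any)
open import Data.Nat.ListAction using (sum)
import Data.List as L
open import Data.Product using (_×_; _,_)
open import Data.Rational using (ℚ; 0ℚ; 1ℚ; _+_; _*_; _/_)

-- A partition is represented by its list of parts (λ₁, …, λ_l), weakly decreasing,
-- positive.  Size |λ| and length ℓ(λ):
size : List ℕ → ℕ
size = sum

len : List ℕ → ℕ
len = length

-- Strict partitions of n.
-- sp n m = list of strict partitions of n with all parts ≤ m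
-- (strictly decreasing lists of positive integers summing to n), each once.
sp : ℕ → ℕ → List (List ℕ)
sp zero    m       = [] ∷ []
sp (suc n) zero    = []
sp (suc n) (suc m) =
  sp (suc n) m ++
  (if suc m ≤ᵇ suc n then map (suc m ∷_) (sp (suc n ∸ suc m) m) else [])

SP : ℕ → List (List ℕ)
SP n = sp n n

-- Shifted Young diagram S(λ) = {(i,j) : 1 ≤ i ≤ ℓ(λ), i ≤ j ≤ λ_i + i - 1}
-- as an explicit list of boxes.
shiftedFrom : ℕ → List ℕ → List (ℕ × ℕ)
shiftedFrom i []       = []
shiftedFrom i (a ∷ as) = map (λ t → (i , i ℕ.+ t)) (upTo a) ++ shiftedFrom (suc i) as

S : List ℕ → List (ℕ × ℕ)
S λ' = shiftedFrom 1 λ'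

eqBox : ℕ × ℕ → ℕ × ℕ → Bool
eqBox (a , b) (c , d) = (a ≡ᵇ c) ∧ (b ≡ᵇ d)

_⊆ᵇ_ : List (ℕ × ℕ) → List (ℕ × ℕ) → Bool
A ⊆ᵇ B = all (λ x → any (eqBox x) B) A

-- g^λ : number of chains ∅ = λ⁽⁰⁾, λ⁽¹⁾, …, λ⁽ⁿ⁾ = λ of strict partitions with
-- S(λ⁽ⁱ⁾) obtained from S(λ⁽ⁱ⁻¹⁾) by adding exactly one box.
-- Counted by the last step: a chain ending at λ (|λ| = k+1) is a chain ending at
-- some strict μ with |μ| = k and S(μ) ⊆ S(λ) (equivalently S(λ) = S(μ) plus one box,
-- since the sizes differ by one), followed by λ.
gAux : ℕ → List ℕ → ℕ
gAux zero    λ' = 1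
gAux (suc k) λ' = sum (map (λ μ → if S μ ⊆ᵇ S λ' then gAux k μ else 0) (SP k))

g : List ℕ → ℕ
g λ' = gAux (size λ') λ'

-- Γ : the ℚ-subalgebra generated by p₁, p₃, p₅, …  Its elements are exactly the
-- values of polynomial expressions with rational coefficients in the odd power sums.
-- (podd k stands for p_{2k+1}.)
data ΓExpr : Set where
  const : ℚ → ΓExpr
  podd  : ℕ → ΓExpr
  _⊕_   : ΓExpr → ΓExpr → ΓExpr
  _⊗_   : ΓExpr → ΓExpr → ΓExpr

ℕ→ℚ : ℕ → ℚ
ℕ→ℚ n = (+ n) / 1

powerSum : ℕ → List ℕ → ℚ
powerSum r λ' = ℕ→ℚ (sum (map (λ a → a ℕ.^ r) λ'))

evalΓ : ΓExpr → List ℕ → ℚ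
evalΓ (const c) λ' = c
evalΓ (podd k)  λ' = powerSum (suc (2 ℕ.* k)) λ'
evalΓ (f ⊕ h)   λ' = evalΓ f λ' + evalΓ h λ'
evalΓ (f ⊗ h)   λ' = evalΓ f λ' * evalΓ h λ'

weight : ℕ → List ℕ → ℚ
weight n λ' = _/_ (+ (2 ℕ.^ (n ∸ len λ') ℕ.* (g λ' ℕ.* g λ'))) (n !) {{n !≢0}}

𝔼 : ℕ → ΓExpr → ℚ
𝔼 n f = L.foldr _+_ 0ℚ (map (λ λ' → weight n λ' * evalΓ f λ') (SP n))

evalPoly : List ℚ → ℚ → ℚ
evalPoly []       x = 0ℚ
evalPoly (c ∷ cs) x = c + x * evalPoly cs x

{-# OPTIONS --safe #-}

-- On functions of a strict partition let (d F)(λ) be the sum of F(μ) over all μ obtained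
-- from λ by removing one box, and let u be the adjoint of d for the weight 2^(|λ| - ℓ(λ)).
-- Then u d - d u = 1, and g restricted to size n is dⁿ applied to the indicator δ of ∅, so
-- n! 𝔼ₙ[f] = (uⁿ f dⁿ δ)(∅).  Moving one d to the left across f shows that the forward
-- difference of 𝔼ₙ[f] in n is a quantity of the same shape with f replaced by the
-- commutator [f , d].  It remains to see that f is ad-nilpotent with respect to d, and by
-- the Leibniz rule only f = p_{2k+1} matters.  The neutral fermions φⱼ (j ∈ ℤ), which insert
-- a part j or delete a part -j, satisfy [φⱼ , d] = φⱼ₋₁, and p_{2k+1} is the quadratic
-- expression in them with coefficients a^{2k+1}; every commutator with d replaces these
-- coefficients by their differences, so 2k+2 commutators give zero.
-- All of this is carried out for partitions with parts at most M; for n ≤ M the truncation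
-- does not influence 𝔼ₙ.

module Submission where

open import Defs
open import Data.Nat using (ℕ)
open import Data.List using (List)
open import Data.Rational using (ℚ)
open import Data.Product using (∃)
open import Relation.Binary.PropositionalEquality using (_≡_)

open import Algebra.Bundles using (CommutativeRing)
import Algebra.Solver.Ring
open import Algebra.Solver.Ring.AlmostCommutativeRing
  using (fromCommutativeRing; _-Raw-AlmostCommutative⟶_)
open import Data.Bool using (Bool; true; false; if_then_else_; _∧_)
open import Data.Bool.ListAction using (all; any)
import Data.Bool.Properties as Boolₚ
open import Data.Empty using (⊥-elim)
open import Data.Integer as ℤ using (ℤ; +_; -[1+_])
import Data.Integer.Properties as ℤₚ
import Data.Integer.Solver
open import Data.List using ([]; _∷_; _++_; map; upTo; foldr)
open import Data.List.Membership.Propositional using (_∈_)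
open import Data.List.Membership.Propositional.Properties
  using (∈-map⁺; ∈-map⁻; ∈-upTo⁺; ∈-upTo⁻; ∈-++⁺ˡ; ∈-++⁺ʳ; ∈-++⁻)
import Data.List.Properties as Listₚ
open import Data.List.Relation.Unary.Any using (here; there)
import Data.Maybe as Maybe
open import Data.Nat as ℕ using (zero; suc; _≡ᵇ_; _≤ᵇ_; _∸_; _!)
open import Data.Nat.ListAction using (sum)
import Data.Nat.Properties as ℕₚ
open import Data.Product using (_×_; _,_; proj₁; proj₂)
open import Data.Rational as ℚ using (0ℚ; 1ℚ)
import Data.Rational.Properties as ℚₚ
import Data.Rational.Solver
open import Data.Rational.Unnormalised as ℚᵘ using (mkℚᵘ; *≡*)
import Data.Rational.Unnormalised.Properties as ℚᵘₚ
open import Data.Sum using (_⊎_; inj₁; inj₂)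
open import Function using (_∘_; mk⇔)
open import Relation.Binary.Consequences using (dec⇒weaklyDec)
open import Relation.Binary.PropositionalEquality
open import Relation.Nullary using (¬_; yes; no)
open import Relation.Nullary.Decidable using (dec-true; dec-false)

-- The ring of functions on strict partitions

module ℚS = Data.Rational.Solver.+-*-Solver
module ℤS = Data.Integer.Solver.+-*-Solver

-- V M is the space of functions on strict partitions with parts ≤ M.  In node F G, F holds
-- the values at partitions without the part M + 1, and G the values at those with it.
data V : ℕ → Set where
  leaf : ℚ → V 0
  node : ∀ {M} → V M → V M → V (suc M)

infixl 6 _+_
infixl 7 _*_
infix  8 -_

_+_ _*_ : ∀ {M} → V M → V M → V M
leaf a   + leaf b   = leaf (a ℚ.+ b)
node F G + node H K = node (F + H) (G + K)
leaf a   * leaf b   = leaf (a ℚ.* b)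
node F G * node H K = node (F * H) (G * K)

-_ : ∀ {M} → V M → V M
- leaf a   = leaf (ℚ.- a)
- node F G = node (- F) (- G)

const# : ∀ M → ℚ → V M
const# zero    c = leaf c
const# (suc M) c = node (const# M c) (const# M c)

0# 1# : ∀ {M} → V M
0# = const# _ 0ℚ
1# = const# _ 1ℚ

infixr 7 _·_
-- Scaling is multiplication by a constant function, so that the ring solver can treat scalars like
-- any other element.
_·_ : ∀ {M} → ℚ → V M → V M
c · F = const# _ c * F

+-assoc : ∀ {M} (F G H : V M) → (F + G) + H ≡ F + (G + H)
+-assoc (leaf a) (leaf b) (leaf c) = cong leaf (ℚₚ.+-assoc a b c)
+-assoc (node a a′) (node b b′) (node c c′) = cong₂ node (+-assoc a b c) (+-assoc a′ b′ c′)

+-comm : ∀ {M} (F G : V M) → F + G ≡ G + F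
+-comm (leaf a) (leaf b) = cong leaf (ℚₚ.+-comm a b)
+-comm (node a a′) (node b b′) = cong₂ node (+-comm a b) (+-comm a′ b′)

+-identityˡ : ∀ {M} (F : V M) → 0# + F ≡ F
+-identityˡ (leaf a) = cong leaf (ℚₚ.+-identityˡ a)
+-identityˡ (node a a′) = cong₂ node (+-identityˡ a) (+-identityˡ a′)

+-inverseˡ : ∀ {M} (F : V M) → - F + F ≡ 0#
+-inverseˡ (leaf a) = cong leaf (ℚₚ.+-inverseˡ a)
+-inverseˡ (node a a′) = cong₂ node (+-inverseˡ a) (+-inverseˡ a′)

*-assoc : ∀ {M} (F G H : V M) → (F * G) * H ≡ F * (G * H)
*-assoc (leaf a) (leaf b) (leaf c) = cong leaf (ℚₚ.*-assoc a b c)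
*-assoc (node a a′) (node b b′) (node c c′) = cong₂ node (*-assoc a b c) (*-assoc a′ b′ c′)

*-comm : ∀ {M} (F G : V M) → F * G ≡ G * F
*-comm (leaf a) (leaf b) = cong leaf (ℚₚ.*-comm a b)
*-comm (node a a′) (node b b′) = cong₂ node (*-comm a b) (*-comm a′ b′)

*-identityˡ : ∀ {M} (F : V M) → 1# * F ≡ F
*-identityˡ (leaf a) = cong leaf (ℚₚ.*-identityˡ a)
*-identityˡ (node a a′) = cong₂ node (*-identityˡ a) (*-identityˡ a′)

*-distribʳ-+ : ∀ {M} (F G H : V M) → (G + H) * F ≡ G * F + H * F
*-distribʳ-+ (leaf a) (leaf b) (leaf c) = cong leaf (ℚₚ.*-distribʳ-+ a b c)
*-distribʳ-+ (node a a′) (node b b′) (node c c′) = cong₂ node (*-distribʳ-+ a b c) (*-distribʳ-+ a′ b′ c′)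

const#-+ : ∀ M a b → const# M (a ℚ.+ b) ≡ const# M a + const# M b
const#-+ zero    a b = refl
const#-+ (suc M) a b = cong₂ node (const#-+ M a b) (const#-+ M a b)

const#-* : ∀ M a b → const# M (a ℚ.* b) ≡ const# M a * const# M b
const#-* zero    a b = refl
const#-* (suc M) a b = cong₂ node (const#-* M a b) (const#-* M a b)

const#-- : ∀ M a → const# M (ℚ.- a) ≡ - const# M a
const#-- zero    a = refl
const#-- (suc M) a = cong₂ node (const#-- M a) (const#-- M a)

V-ring : ℕ → CommutativeRing _ _
V-ring M = record
  { Carrier = V M ; _≈_ = _≡_ ; _+_ = _+_ ; _*_ = _*_ ; -_ = -_ ; 0# = 0# ; 1# = 1#
  ; isCommutativeRing = record
    { isRing = record
      { +-isAbelianGroup = record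
        { isGroup = record
          { isMonoid = record
            { isSemigroup = record
              { isMagma = record { isEquivalence = isEquivalence ; ∙-cong = cong₂ _+_ }
              ; assoc = +-assoc }
            ; identity = +-identityˡ , λ F → trans (+-comm F 0#) (+-identityˡ F) }
          ; inverse = +-inverseˡ , λ F → trans (+-comm F (- F)) (+-inverseˡ F)
          ; ⁻¹-cong = cong -_ }
        ; comm = +-comm }
      ; *-cong = cong₂ _*_
      ; *-assoc = *-assoc
      ; *-identity = *-identityˡ , λ F → trans (*-comm F 1#) (*-identityˡ F)
      ; distrib = (λ F G H → trans (*-comm F (G + H)) (trans (*-distribʳ-+ F G H) (cong₂ _+_ (*-comm G F) (*-comm H F))))
                , *-distribʳ-+ }
    ; *-comm = *-comm } }

const#-morphism : ∀ M → CommutativeRing.rawRing ℚₚ.+-*-commutativeRing -Raw-AlmostCommutative⟶ fromCommutativeRing (V-ring M)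
const#-morphism M = record
  { ⟦_⟧ = const# M ; +-homo = const#-+ M ; *-homo = const#-* M ; -‿homo = const#-- M
  ; 0-homo = refl ; 1-homo = refl }

-- The coefficients are rationals rather than elements of `V M`: equality of closed coefficients is
-- then decided by computation in ℚ, although `const# M` does not reduce for a variable M.
module VS (M : ℕ) = Algebra.Solver.Ring (CommutativeRing.rawRing ℚₚ.+-*-commutativeRing)
  (fromCommutativeRing (V-ring M)) (const#-morphism M)
  (λ a b → Maybe.map (cong (const# M)) (dec⇒weaklyDec ℚₚ._≟_ a b))

-- Integers inside ℚ, and reciprocals of factorials

ι : ℤ → ℚ
ι a = a ℚ./ 1

-- Division in ℚ normalises by a gcd, which blocks computation on variables; in ℚᵘ the fraction
-- keeps its numerator and denominator.
toℚᵘ-ι : ∀ a → ℚ.toℚᵘ (ι a) ℚᵘ.≃ mkℚᵘ a 0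
toℚᵘ-ι a = ℚₚ.toℚᵘ-fromℚᵘ (mkℚᵘ a 0)

ι-+ : ∀ a b → ι (a ℤ.+ b) ≡ ι a ℚ.+ ι b
ι-+ a b = ℚₚ.toℚᵘ-injective (begin
  ℚ.toℚᵘ (ι (a ℤ.+ b))           ≈⟨ toℚᵘ-ι (a ℤ.+ b) ⟩
  mkℚᵘ (a ℤ.+ b) 0               ≈⟨ *≡* (cong (ℤ._* + 1) (cong₂ ℤ._+_ (sym (ℤₚ.*-identityʳ a)) (sym (ℤₚ.*-identityʳ b)))) ⟩
  mkℚᵘ a 0 ℚᵘ.+ mkℚᵘ b 0         ≈⟨ ℚᵘₚ.+-cong (toℚᵘ-ι a) (toℚᵘ-ι b) ⟨
  ℚ.toℚᵘ (ι a) ℚᵘ.+ ℚ.toℚᵘ (ι b) ≈⟨ ℚₚ.toℚᵘ-homo-+ (ι a) (ι b) ⟨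
  ℚ.toℚᵘ (ι a ℚ.+ ι b)           ∎)
  where open ℚᵘₚ.≃-Reasoning

ι-* : ∀ a b → ι (a ℤ.* b) ≡ ι a ℚ.* ι b
ι-* a b = ℚₚ.toℚᵘ-injective (begin
  ℚ.toℚᵘ (ι (a ℤ.* b))           ≈⟨ toℚᵘ-ι (a ℤ.* b) ⟩
  mkℚᵘ a 0 ℚᵘ.* mkℚᵘ b 0         ≈⟨ ℚᵘₚ.*-cong (toℚᵘ-ι a) (toℚᵘ-ι b) ⟨
  ℚ.toℚᵘ (ι a) ℚᵘ.* ℚ.toℚᵘ (ι b) ≈⟨ ℚₚ.toℚᵘ-homo-* (ι a) (ι b) ⟨
  ℚ.toℚᵘ (ι a ℚ.* ι b)           ∎)
  where open ℚᵘₚ.≃-Reasoning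

ι-- : ∀ a → ι (ℤ.- a) ≡ ℚ.- ι a
ι-- a = ℚₚ.toℚᵘ-injective (begin
  ℚ.toℚᵘ (ι (ℤ.- a))   ≈⟨ toℚᵘ-ι (ℤ.- a) ⟩
  ℚᵘ.- mkℚᵘ a 0        ≈⟨ ℚᵘₚ.-‿cong (toℚᵘ-ι a) ⟨
  ℚᵘ.- ℚ.toℚᵘ (ι a)    ≈⟨ ℚₚ.toℚᵘ-homo‿- (ι a) ⟨
  ℚ.toℚᵘ (ℚ.- ι a)     ∎)
  where open ℚᵘₚ.≃-Reasoning

ℕ→ℚ-+ : ∀ m n → ℕ→ℚ (m ℕ.+ n) ≡ ℕ→ℚ m ℚ.+ ℕ→ℚ n
ℕ→ℚ-+ m n = ι-+ (+ m) (+ n)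

ℕ→ℚ-* : ∀ m n → ℕ→ℚ (m ℕ.* n) ≡ ℕ→ℚ m ℚ.* ℕ→ℚ n
ℕ→ℚ-* m n = trans (cong ι (ℤₚ.pos-* m n)) (ι-* (+ m) (+ n))

ℕ→ℚ-suc : ∀ n → ℕ→ℚ (suc n) ≡ 1ℚ ℚ.+ ℕ→ℚ n
ℕ→ℚ-suc n = ℕ→ℚ-+ 1 n

1/! : ℕ → ℚ
1/! n = ℚ._/_ (+ 1) (n !) {{n ℕₚ.!≢0}}

toℚᵘ-/ : ∀ a n .{{_ : ℕ.NonZero n}} → ℚ.toℚᵘ (a ℚ./ n) ℚᵘ.≃ a ℚᵘ./ n
toℚᵘ-/ a (suc n) = ℚₚ.toℚᵘ-fromℚᵘ (mkℚᵘ a n)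

/-as-* : ∀ a n .{{_ : ℕ.NonZero n}} → a ℚ./ n ≡ ι a ℚ.* (+ 1 ℚ./ n)
/-as-* a n@(suc m) = ℚₚ.toℚᵘ-injective (begin
  ℚ.toℚᵘ (a ℚ./ n)                         ≈⟨ toℚᵘ-/ a n ⟩
  mkℚᵘ a m                                 ≈⟨ *≡* (cong₂ ℤ._*_ (sym (ℤₚ.*-identityʳ a)) (ℤₚ.*-identityˡ (+ n))) ⟩
  mkℚᵘ a 0 ℚᵘ.* mkℚᵘ (+ 1) m               ≈⟨ ℚᵘₚ.*-cong (toℚᵘ-ι a) (toℚᵘ-/ (+ 1) n) ⟨
  ℚ.toℚᵘ (ι a) ℚᵘ.* ℚ.toℚᵘ (+ 1 ℚ./ n)     ≈⟨ ℚₚ.toℚᵘ-homo-* (ι a) (+ 1 ℚ./ n) ⟨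
  ℚ.toℚᵘ (ι a ℚ.* (+ 1 ℚ./ n))             ∎)
  where open ℚᵘₚ.≃-Reasoning

cancel-/ : ∀ m n .{{_ : ℕ.NonZero m}} .{{_ : ℕ.NonZero n}} → ℕ→ℚ m ℚ.* (ℚ._/_ (+ 1) (m ℕ.* n) {{ℕₚ.m*n≢0 m n}}) ≡ + 1 ℚ./ n
cancel-/ m@(suc m′) n@(suc n′) = trans (sym (/-as-* (+ m) (m ℕ.* n))) (ℚₚ.toℚᵘ-injective (begin
  ℚ.toℚᵘ (+ m ℚ./ (m ℕ.* n))   ≈⟨ toℚᵘ-/ (+ m) (m ℕ.* n) ⟩
  + m ℚᵘ./ (m ℕ.* n)           ≈⟨ *≡* (trans (sym (ℤₚ.pos-* m n)) (sym (ℤₚ.*-identityˡ (+ (m ℕ.* n))))) ⟩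
  + 1 ℚᵘ./ n                   ≈⟨ toℚᵘ-/ (+ 1) n ⟨
  ℚ.toℚᵘ (+ 1 ℚ./ n)           ∎))
  where open ℚᵘₚ.≃-Reasoning

1/!-suc : ∀ n → ℕ→ℚ (suc n) ℚ.* 1/! (suc n) ≡ 1/! n
1/!-suc n = cancel-/ (suc n) (n !) {{_}} {{n ℕₚ.!≢0}}

open ≡-Reasoning

-- Fermions, box removal and box addition

2ℚ : ℚ
2ℚ = 1ℚ ℚ.+ 1ℚ

-- κ M i is 2 (-1)^M if i = 2 M, and 0 otherwise: the anticommutator of φ_M and φ_{M - i}.
κ : ℕ → ℕ → ℚ
κ zero    zero          = 2ℚ
κ zero    (suc i)       = 0ℚ
κ (suc M) zero          = 0ℚ
κ (suc M) (suc zero)    = 0ℚ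
κ (suc M) (suc (suc i)) = ℚ.- κ M i

-- On V M, φ i is the fermion φ_{M - i}: for i < M it inserts the part M - i, for i = M it is
-- (-1)^ℓ, and for i > M it deletes the part i - M with a factor ± 2.  Each comes with a sign
-- counting the larger parts, whence the minus sign in the last clause.
φ : ∀ {M} → ℕ → V M → V M
φ {zero}  zero    F          = F
φ {zero}  (suc i) F          = 0#
φ {suc M} zero    (node F G) = node G 0#
φ {suc M} (suc i) (node F G) = node (φ i F) (κ (suc M) (suc i) · F + - φ i G)

-- Operators act on functions: (X F)(λ) evaluates F at the partitions reached from λ by the
-- move X.  Turning the top part M + 1 into M is φ 0 on V M; for M = 0 it removes the part 1.
d : ∀ {M} → V M → V M
d (leaf _)   = 0#
d (node F G) = node (d F) (d G + φ 0 F)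

-- The transpose of `φ 0` that `u` needs. The factor 2 is the ratio of the weights 2^M and 2^(M - 1)
-- of the parts M + 1 and M; a new part 1 has weight 1, hence no factor on a leaf.
φᵀ : ∀ {M} → V M → V M
φᵀ (leaf a)   = leaf a
φᵀ (node F G) = node 0# (2ℚ · F)

u : ∀ {M} → V M → V M
u (leaf _)   = 0#
u (node F G) = node (u F + φᵀ G) (u G)

φ-+ : ∀ {M} i (F G : V M) → φ i (F + G) ≡ φ i F + φ i G
φ-+ zero    (leaf _)   (leaf _)   = refl
φ-+ (suc i) (leaf _)   (leaf _)   = refl
φ-+ {suc M} zero (node F G) (node H K) = cong (node _) (solve 0 (con 0ℚ := con 0ℚ :+ con 0ℚ) refl)
  where open VS M
φ-+ {suc M} (suc i) (node F G) (node H K) = cong₂ node (φ-+ i F H) (begin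
  k * (F + H) + - φ i (G + K)        ≡⟨ cong (λ z → k * (F + H) + - z) (φ-+ i G K) ⟩
  k * (F + H) + - (φ i G + φ i K)    ≡⟨ solve 5 (λ k F H g h → k :* (F :+ H) :+ :- (g :+ h) := (k :* F :+ :- g) :+ (k :* H :+ :- h)) refl k F H (φ i G) (φ i K) ⟩
  (k * F + - φ i G) + (k * H + - φ i K) ∎)
  where open VS M
        k = const# M (κ (suc M) (suc i))

φ-· : ∀ {M} i c (F : V M) → φ i (c · F) ≡ c · φ i F
φ-· zero    c (leaf _)   = refl
φ-· (suc i) c (leaf _)   = cong leaf (sym (ℚₚ.*-zeroʳ c))
φ-· {suc M} zero c (node F G) = cong (node _) (solve 1 (λ c → con 0ℚ := c :* con 0ℚ) refl (const# M c))
  where open VS M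
φ-· {suc M} (suc i) c (node F G) = cong₂ node (φ-· i c F) (begin
  k * (c · F) + - φ i (c · G)        ≡⟨ cong (λ z → k * (c · F) + - z) (φ-· i c G) ⟩
  k * (c · F) + - (c · φ i G)    ≡⟨ solve 4 (λ k c F g → k :* (c :* F) :+ :- (c :* g) := c :* (k :* F :+ :- g)) refl k (const# M c) F (φ i G) ⟩
  c · (k * F + - φ i G) ∎)
  where open VS M
        k = const# M (κ (suc M) (suc i))

d-+ : ∀ {M} (F G : V M) → d (F + G) ≡ d F + d G
d-+ (leaf _) (leaf _) = refl
d-+ {suc M} (node F G) (node H K) = cong₂ node (d-+ F H) (begin
  d (G + K) + φ 0 (F + H)                  ≡⟨ cong₂ _+_ (d-+ G K) (φ-+ 0 F H) ⟩
  (d G + d K) + (φ 0 F + φ 0 H)            ≡⟨ solve 4 (λ a b c d → (a :+ b) :+ (c :+ d) := (a :+ c) :+ (b :+ d)) refl (d G) (d K) (φ 0 F) (φ 0 H) ⟩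
  (d G + φ 0 F) + (d K + φ 0 H)            ∎)
  where open VS M

d-· : ∀ {M} c (F : V M) → d (c · F) ≡ c · d F
d-· c (leaf _) = cong leaf (sym (ℚₚ.*-zeroʳ c))
d-· {suc M} c (node F G) = cong₂ node (d-· c F) (begin
  d (c · G) + φ 0 (c · F)  ≡⟨ cong₂ _+_ (d-· c G) (φ-· 0 c F) ⟩
  c · d G + c · φ 0 F      ≡⟨ solve 3 (λ c a b → c :* a :+ c :* b := c :* (a :+ b)) refl (const# M c) (d G) (φ 0 F) ⟩
  c · (d G + φ 0 F)        ∎)
  where open VS M

φᵀ-+ : ∀ {M} (F G : V M) → φᵀ (F + G) ≡ φᵀ F + φᵀ G
φᵀ-+ (leaf _) (leaf _) = refl
φᵀ-+ {suc M} (node F G) (node H K) = cong₂ node (solve 0 (con 0ℚ := con 0ℚ :+ con 0ℚ) refl) (solve 2 (λ F H → con 2ℚ :* (F :+ H) := con 2ℚ :* F :+ con 2ℚ :* H) refl F H)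
  where open VS M

u-+ : ∀ {M} (F G : V M) → u (F + G) ≡ u F + u G
u-+ (leaf _) (leaf _) = refl
u-+ {suc M} (node F G) (node H K) = cong₂ node (begin
  u (F + H) + φᵀ (G + K)                  ≡⟨ cong₂ _+_ (u-+ F H) (φᵀ-+ G K) ⟩
  (u F + u H) + (φᵀ G + φᵀ K)            ≡⟨ solve 4 (λ a b c d → (a :+ b) :+ (c :+ d) := (a :+ c) :+ (b :+ d)) refl (u F) (u H) (φᵀ G) (φᵀ K) ⟩
  (u F + φᵀ G) + (u H + φᵀ K)            ∎) (u-+ G K)
  where open VS M

additive⇒0 : ∀ {M N} (f : V M → V N) → (∀ F G → f (F + G) ≡ f F + f G) → f 0# ≡ 0#
additive⇒0 {M} {N} f f-+ = begin
  f 0#                   ≡⟨ solve 1 (λ a → a := (a :+ a) :+ :- a) refl (f 0#) ⟩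
  (f 0# + f 0#) + - f 0# ≡⟨ cong (_+ - f 0#) (f-+ 0# 0#) ⟨
  f (0# + 0#) + - f 0#   ≡⟨ cong (λ z → f z + - f 0#) (+-identityˡ 0#) ⟩
  f 0# + - f 0#          ≡⟨ solve 1 (λ a → a :+ :- a := con 0ℚ) refl (f 0#) ⟩
  0#                     ∎
  where open VS N

additive⇒- : ∀ {M N} (f : V M → V N) → (∀ F G → f (F + G) ≡ f F + f G) → ∀ F → f (- F) ≡ - f F
additive⇒- {M} {N} f f-+ F = begin
  f (- F)                 ≡⟨ solve 2 (λ a b → a := (a :+ b) :+ :- b) refl (f (- F)) (f F) ⟩
  (f (- F) + f F) + - f F ≡⟨ cong (_+ - f F) (f-+ (- F) F) ⟨
  f (- F + F) + - f F     ≡⟨ cong (λ z → f z + - f F) (+-inverseˡ F) ⟩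
  f 0# + - f F            ≡⟨ cong (_+ - f F) (additive⇒0 f f-+) ⟩
  0# + - f F              ≡⟨ +-identityˡ (- f F) ⟩
  - f F                   ∎
  where open VS N

-- A Clifford relation. No induction is involved: `φ 0` only moves one half of a node to the other,
-- and what remains is the κ-term built into the last clause of `φ`.
φ-anticomm : ∀ {M} i (F : V M) → φ i (φ 0 F) + φ 0 (φ i F) ≡ κ M i · F
φ-anticomm {zero} zero    (leaf a) = cong leaf (ℚS.solve 1 (λ a → a ℚS.:+ a ℚS.:= ℚS.con 2ℚ ℚS.:* a) refl a)
φ-anticomm {zero} (suc i) (leaf a) = cong leaf (sym (ℚₚ.*-zeroˡ a))
φ-anticomm {suc M} zero (node F G) = cong₂ node (solve 1 (λ F → con 0ℚ :+ con 0ℚ := con 0ℚ :* F) refl F) (solve 1 (λ F → con 0ℚ :+ con 0ℚ := con 0ℚ :* F) refl G)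
  where open VS M
φ-anticomm {suc M} (suc i) (node F G) = cong₂ node
  (solve 3 (λ k F g → g :+ (k :* F :+ :- g) := k :* F) refl k F (φ i G))
  (begin
    (k * G + - φ i 0#) + 0#  ≡⟨ cong (λ z → (k * G + - z) + 0#) (additive⇒0 (φ i) (φ-+ i)) ⟩
    (k * G + - 0#) + 0#      ≡⟨ solve 2 (λ k G → (k :* G :+ :- con 0ℚ) :+ con 0ℚ := k :* G) refl k G ⟩
    k * G ∎)
  where
    open VS M
    k = const# M (κ (suc M) (suc i))

-- Box removal lowers the index of a fermion by one. Passing the top summand `φ 0` of `d` costs an
-- anticommutator, which accounts for the recursion `κ (suc M) (suc (suc i)) = - κ M i`.
φ-d : ∀ {M} i (F : V M) → φ i (d F) ≡ d (φ i F) + φ (suc i) F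
φ-d zero    (leaf a) = refl
φ-d (suc i) (leaf a) = refl
φ-d {suc M} zero (node F G) = cong₂ node
  (solve 2 (λ G F → G :+ F := G :+ F) refl (d G) (φ 0 F))
  (begin
    0# ≡⟨ solve 1 (λ g → con 0ℚ := con 0ℚ :+ g :+ (con 0ℚ :+ :- g)) refl (φ 0 G) ⟩
    0# + φ 0 G + (0# + - φ 0 G) ≡⟨ cong₂ (λ a b → a + φ 0 G + (b + - φ 0 G)) (sym (additive⇒0 d d-+)) (solve 1 (λ F → con 0ℚ := con 0ℚ :* F) refl F) ⟩
    d 0# + φ 0 G + (0# * F + - φ 0 G) ∎)
  where open VS M
φ-d {suc M} (suc i) (node F G) = cong₂ node (φ-d i F) (begin
  k * d F + - φ i (d G + φ 0 F)
    ≡⟨ cong (λ z → k * d F + - z) (trans (φ-+ i (d G) (φ 0 F)) (cong (_+ φ i (φ 0 F)) (φ-d i G))) ⟩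
  k * d F + - (d (φ i G) + φ (suc i) G + φ i (φ 0 F))
    -- `φ 0 (φ i F)` is added and subtracted: one copy belongs to `d` of the node, the other
    -- completes the anticommutator.
    ≡⟨ solve 5 (λ a b c e f → a :+ :- (b :+ c :+ e) := a :+ :- b :+ f :+ (:- (e :+ f) :+ :- c)) refl (k * d F) (d (φ i G)) (φ (suc i) G) (φ i (φ 0 F)) (φ 0 (φ i F)) ⟩
  k * d F + - d (φ i G) + φ 0 (φ i F) + (- (φ i (φ 0 F) + φ 0 (φ i F)) + - φ (suc i) G)
    ≡⟨ cong₂ (λ a b → a + φ 0 (φ i F) + (b + - φ (suc i) G)) (sym dk) (trans (cong -_ (φ-anticomm i F))
         (trans (solve 2 (λ a b → :- (a :* b) := (:- a) :* b) refl (const# M (κ M i)) F) (cong (_* F) (sym (const#-- M (κ M i)))))) ⟩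
  d (k * F + - φ i G) + φ 0 (φ i F) + (κ (suc M) (suc (suc i)) · F + - φ (suc i) G) ∎)
  where
    open VS M
    k = const# M (κ (suc M) (suc i))
    dk : d (k * F + - φ i G) ≡ k * d F + - d (φ i G)
    dk = trans (d-+ (k * F) (- φ i G)) (cong₂ _+_ (d-· (κ (suc M) (suc i)) F) (additive⇒- d d-+ (φ i G)))

-- The truncation turns the commutator [u , d] into σ instead of the identity, because the
-- part M cannot grow.
σ : ∀ {M} → V M → V M
σ (leaf _)   = 0#
σ (node F G) = node F (- G)

φᵀ-d : ∀ {M} (F : V M) → φᵀ (d F) ≡ d (φᵀ F)
φᵀ-d (leaf _) = refl
φᵀ-d {suc M} (node F G) = cong₂ node (sym (additive⇒0 d d-+)) (begin
  2ℚ · d F                 ≡⟨ d-· 2ℚ F ⟨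
  d (2ℚ · F)               ≡⟨ solve 1 (λ a → a := a :+ con 0ℚ) refl (d (2ℚ · F)) ⟩
  d (2ℚ · F) + 0#          ≡⟨ cong (λ z → d (2ℚ · F) + z) (additive⇒0 (φ 0) (φ-+ 0)) ⟨
  d (2ℚ · F) + φ 0 0#      ∎)
  where open VS M

u-φ : ∀ {M} (F : V M) → u (φ 0 F) ≡ φ 0 (u F)
u-φ (leaf _) = refl
u-φ {suc M} (node F G) = cong₂ node
  (begin
    u G + φᵀ 0#  ≡⟨ cong (λ z → u G + z) (additive⇒0 φᵀ φᵀ-+) ⟩
    u G + 0#     ≡⟨ solve 1 (λ a → a :+ con 0ℚ := a) refl (u G) ⟩
    u G          ∎)
  (additive⇒0 u u-+)
  where open VS M

σ-φᵀ-φ : ∀ {M} (F : V M) → σ F + φᵀ (φ 0 F) ≡ F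
σ-φᵀ-φ (leaf a) = cong leaf (ℚₚ.+-identityˡ a)
σ-φᵀ-φ {suc M} (node F G) = cong₂ node
  (solve 1 (λ F → F :+ con 0ℚ := F) refl F)
  (solve 1 (λ G → :- G :+ con 2ℚ :* G := G) refl G)
  where open VS M

σ-φ-φᵀ : ∀ {M} (F : V M) → σ F ≡ φ 0 (φᵀ F) + - F
σ-φ-φᵀ (leaf a) = cong leaf (sym (ℚₚ.+-inverseʳ a))
σ-φ-φᵀ {suc M} (node F G) = cong₂ node
  (solve 1 (λ F → F := con 2ℚ :* F :+ :- F) refl F)
  (solve 1 (λ G → :- G := con 0ℚ :+ :- G) refl G)
  where open VS M

-- Induction on the largest allowed part. On partitions without M + 1, the exchanges of M and M + 1
-- supply what `σ` lacks to the identity (`σ-φᵀ-φ`); on those with it, they absorb all of `σ` except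
-- minus the identity (`σ-φ-φᵀ`). So the defect moves up to the new largest part.
u-d : ∀ {M} (F : V M) → u (d F) ≡ d (u F) + σ F
u-d (leaf _) = refl
u-d {suc M} (node F G) = cong₂ node
  (begin
    u (d F) + φᵀ (d G + φ 0 F)
      ≡⟨ cong₂ _+_ (u-d F) (trans (φᵀ-+ (d G) (φ 0 F)) (cong (_+ φᵀ (φ 0 F)) (φᵀ-d G))) ⟩
    (d (u F) + σ F) + (d (φᵀ G) + φᵀ (φ 0 F))
      ≡⟨ solve 4 (λ a b c e → (a :+ b) :+ (c :+ e) := (a :+ c) :+ (b :+ e)) refl (d (u F)) (σ F) (d (φᵀ G)) (φᵀ (φ 0 F)) ⟩
    (d (u F) + d (φᵀ G)) + (σ F + φᵀ (φ 0 F))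
      ≡⟨ cong₂ _+_ (sym (d-+ (u F) (φᵀ G))) (σ-φᵀ-φ F) ⟩
    d (u F + φᵀ G) + F ∎)
  (begin
    u (d G + φ 0 F)
      ≡⟨ trans (u-+ (d G) (φ 0 F)) (cong₂ _+_ (u-d G) (u-φ F)) ⟩
    (d (u G) + σ G) + φ 0 (u F)
      ≡⟨ cong (λ z → (d (u G) + z) + φ 0 (u F)) (σ-φ-φᵀ G) ⟩
    (d (u G) + (φ 0 (φᵀ G) + - G)) + φ 0 (u F)
      ≡⟨ solve 4 (λ a b c e → (a :+ (b :+ e)) :+ c := a :+ (c :+ b) :+ e) refl (d (u G)) (φ 0 (φᵀ G)) (φ 0 (u F)) (- G) ⟩
    d (u G) + (φ 0 (u F) + φ 0 (φᵀ G)) + - G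
      ≡⟨ cong (λ z → d (u G) + z + - G) (φ-+ 0 (u F) (φᵀ G)) ⟨
    d (u G) + φ 0 (u F + φᵀ G) + - G ∎)
  where open VS M

-- Vacuum expectations

vac : ∀ {M} → V M → ℚ
vac (leaf a)   = a
vac (node F _) = vac F

vac-+ : ∀ {M} (F G : V M) → vac (F + G) ≡ vac F ℚ.+ vac G
vac-+ (leaf _)   (leaf _)   = refl
vac-+ (node F _) (node G _) = vac-+ F G

vac-d : ∀ {M} (F : V M) → vac (d F) ≡ 0ℚ
vac-d (leaf _)   = refl
vac-d (node F _) = vac-d F

vac-0 : ∀ {M} → vac (0# {M}) ≡ 0ℚ
vac-0 {zero}  = refl
vac-0 {suc M} = vac-0 {M}

-- The value of uⁿ F at ∅. By `⟪γ,⟫` it is also the weighted sum of g times F over the partitions of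
-- size n.
ε : ∀ {M} → ℕ → V M → ℚ
ε zero    F = vac F
ε (suc n) F = ε n (u F)

ε-+ : ∀ {M} n (F G : V M) → ε n (F + G) ≡ ε n F ℚ.+ ε n G
ε-+ zero    F G = vac-+ F G
ε-+ (suc n) F G = trans (cong (ε n) (u-+ F G)) (ε-+ n (u F) (u G))

ε-0 : ∀ {M} n → ε n (0# {M}) ≡ 0ℚ
ε-0 {M} zero = vac-0 {M}
ε-0 (suc n)  = trans (cong (ε n) (additive⇒0 u u-+)) (ε-0 n)

-- ε n only sees partitions of size n, which have no part larger than n.
ε-node : ∀ {M} n (F G : V M) → n ℕ.≤ M → ε n (node F G) ≡ ε n F
ε-φᵀ : ∀ {M} n (G : V M) → n ℕ.< M → ε n (φᵀ G) ≡ 0ℚ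

ε-node         zero    F G n≤M = refl
ε-node {suc M} (suc n) F G n<M = begin
  ε n (node (u F + φᵀ G) (u G)) ≡⟨ ε-node n _ _ (ℕₚ.<⇒≤ n<M) ⟩
  ε n (u F + φᵀ G)              ≡⟨ ε-+ n (u F) (φᵀ G) ⟩
  ε n (u F) ℚ.+ ε n (φᵀ G)      ≡⟨ cong (ε n (u F) ℚ.+_) (ε-φᵀ n G n<M) ⟩
  ε n (u F) ℚ.+ 0ℚ              ≡⟨ ℚₚ.+-identityʳ _ ⟩
  ε n (u F)                     ∎
ε-φᵀ {suc M} n (node F G) (ℕ.s≤s n≤M) = trans (ε-node n 0# (2ℚ · F) n≤M) (ε-0 n)

-- `σ` differs from the identity only at partitions containing the part M, and these are too large
-- to be seen.
ε-σ : ∀ {M} n (F : V M) → n ℕ.< M → ε n (σ F) ≡ ε n F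
ε-σ n (node F G) (ℕ.s≤s n≤M) = trans (ε-node n F (- G) n≤M) (sym (ε-node n F G n≤M))

-- The `d` is moved to the left through n + 1 copies of `u`. Each crossing leaves one `ε n F`, and
-- at the vacuum `d` contributes nothing because ∅ has no box to remove.
ε-d : ∀ {M} n (F : V M) → n ℕ.< M → ε (suc n) (d F) ≡ ℕ→ℚ (suc n) ℚ.* ε n F
ε-d n F n<M = begin
  ε n (u (d F))                  ≡⟨ cong (ε n) (u-d F) ⟩
  ε n (d (u F) + σ F)            ≡⟨ ε-+ n (d (u F)) (σ F) ⟩
  ε n (d (u F)) ℚ.+ ε n (σ F)    ≡⟨ cong₂ ℚ._+_ (step n n<M) (ε-σ n F n<M) ⟩
  ℕ→ℚ n ℚ.* ε n F ℚ.+ ε n F      ≡⟨ ℚS.solve 2 (λ a b → a ℚS.:* b ℚS.:+ b ℚS.:= (ℚS.con 1ℚ ℚS.:+ a) ℚS.:* b) refl (ℕ→ℚ n) (ε n F) ⟩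
  (1ℚ ℚ.+ ℕ→ℚ n) ℚ.* ε n F       ≡⟨ cong (ℚ._* ε n F) (ℕ→ℚ-suc n) ⟨
  ℕ→ℚ (suc n) ℚ.* ε n F          ∎
  where
    step : ∀ n → n ℕ.< _ → ε n (d (u F)) ≡ ℕ→ℚ n ℚ.* ε n F
    step zero    _   = trans (vac-d (u F)) (sym (ℚₚ.*-zeroˡ (vac F)))
    step (suc n) n<M = ε-d n (u F) (ℕₚ.<⇒≤ n<M)

-- Commutators of power sums with box removal

∇ : ℕ → (ℤ → ℤ) → ℤ → ℤ
∇ zero    f a = f a
∇ (suc r) f a = ∇ r f a ℤ.- ∇ r f (a ℤ.- + 1)

-- The iterated product rule has only two terms because second differences of the identity function
-- vanish.
∇-leibniz : ∀ r f a → ∇ (suc r) (λ b → b ℤ.* f b) a ≡ a ℤ.* ∇ (suc r) f a ℤ.+ + suc r ℤ.* ∇ r f (a ℤ.- + 1)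
∇-leibniz zero f a =
  ℤS.solve 3 (λ a x y → a :* x :- (a :- con (+ 1)) :* y := a :* (x :- y) :+ con (+ 1) :* y) refl a (f a) (f (a ℤ.- + 1))
  where open ℤS
∇-leibniz (suc r) f a = begin
  ∇ (suc r) (λ b → b ℤ.* f b) a ℤ.- ∇ (suc r) (λ b → b ℤ.* f b) (a ℤ.- + 1)
    ≡⟨ cong₂ ℤ._-_ (∇-leibniz r f a) (∇-leibniz r f (a ℤ.- + 1)) ⟩
  (a ℤ.* (x ℤ.- y) ℤ.+ + suc r ℤ.* y) ℤ.- ((a ℤ.- + 1) ℤ.* (y ℤ.- z) ℤ.+ + suc r ℤ.* z)
    ≡⟨ ℤS.solve 5 (λ a x y z n → (a :* (x :- y) :+ n :* y) :- ((a :- con (+ 1)) :* (y :- z) :+ n :* z)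
                              := a :* ((x :- y) :- (y :- z)) :+ (con (+ 1) :+ n) :* (y :- z)) refl a x y z (+ suc r) ⟩
  a ℤ.* ((x ℤ.- y) ℤ.- (y ℤ.- z)) ℤ.+ + suc (suc r) ℤ.* (y ℤ.- z) ∎
  where
    open ℤS
    x = ∇ r f a
    y = ∇ r f (a ℤ.- + 1)
    z = ∇ r f (a ℤ.- + 1 ℤ.- + 1)

∇-^ : ∀ r a → ∇ (suc r) (ℤ._^ r) a ≡ + 0
∇-^ zero    a = refl
∇-^ (suc r) a = begin
  ∇ (suc (suc r)) (ℤ._^ suc r) a ≡⟨ ∇-leibniz (suc r) (ℤ._^ r) a ⟩
  a ℤ.* (∇ (suc r) (ℤ._^ r) a ℤ.- ∇ (suc r) (ℤ._^ r) (a ℤ.- + 1)) ℤ.+ + suc (suc r) ℤ.* ∇ (suc r) (ℤ._^ r) (a ℤ.- + 1)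
    ≡⟨ cong₂ (λ x y → a ℤ.* (x ℤ.- y) ℤ.+ + suc (suc r) ℤ.* y) (∇-^ r a) (∇-^ r (a ℤ.- + 1)) ⟩
  a ℤ.* + 0 ℤ.+ + suc (suc r) ℤ.* + 0 ≡⟨ cong₂ ℤ._+_ (ℤₚ.*-zeroʳ a) (ℤₚ.*-zeroʳ (+ suc (suc r))) ⟩
  + 0 ∎

Odd : (ℤ → ℤ) → Set
Odd q = ∀ a → q (ℤ.- a) ≡ ℤ.- q a

^-odd : ∀ k → Odd (ℤ._^ suc (2 ℕ.* k))
^-odd k a = begin
  (ℤ.- a) ℤ.* (ℤ.- a) ℤ.^ (2 ℕ.* k)  ≡⟨ cong ((ℤ.- a) ℤ.*_) (ℤₚ.^-*-assoc (ℤ.- a) 2 k) ⟨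
  (ℤ.- a) ℤ.* ((ℤ.- a) ℤ.^ 2) ℤ.^ k  ≡⟨ cong (λ b → (ℤ.- a) ℤ.* b ℤ.^ k) (ℤS.solve 1 (λ a → (:- a) :* ((:- a) :* con (+ 1)) := a :* (a :* con (+ 1))) refl a) ⟩
  (ℤ.- a) ℤ.* (a ℤ.^ 2) ℤ.^ k        ≡⟨ cong ((ℤ.- a) ℤ.*_) (ℤₚ.^-*-assoc a 2 k) ⟩
  (ℤ.- a) ℤ.* a ℤ.^ (2 ℕ.* k)        ≡⟨ ℤₚ.neg-distribˡ-* a (a ℤ.^ (2 ℕ.* k)) ⟨
  ℤ.- (a ℤ.* a ℤ.^ (2 ℕ.* k))        ∎
  where open ℤS

sign : ℕ → ℤ
sign zero    = -[1+ 0 ]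
sign (suc r) = ℤ.- sign r

-- An r-fold backward difference at a samples the points a - r, ..., a, so the reflection of the
-- sample points about 0 sends a to r - a.
∇-odd : ∀ {q} → Odd q → ∀ r a → ∇ r q (+ r ℤ.- a) ≡ sign r ℤ.* ∇ r q a
∇-odd {q} odd zero a = begin
  q (+ 0 ℤ.- a)          ≡⟨ cong q (ℤₚ.+-identityˡ (ℤ.- a)) ⟩
  q (ℤ.- a)              ≡⟨ odd a ⟩
  ℤ.- q a                ≡⟨ ℤₚ.-1*i≡-i (q a) ⟨
  -[1+ 0 ] ℤ.* q a       ∎
∇-odd {q} odd (suc r) a = begin
  ∇ r q (+ suc r ℤ.- a) ℤ.- ∇ r q (+ suc r ℤ.- a ℤ.- + 1)
    ≡⟨ cong₂ (λ b c → ∇ r q b ℤ.- ∇ r q c)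
        (ℤS.solve 2 (λ r a → (con (+ 1) :+ r) :- a := r :- (a :- con (+ 1))) refl (+ r) a)
        (ℤS.solve 2 (λ r a → ((con (+ 1) :+ r) :- a) :- con (+ 1) := r :- a) refl (+ r) a) ⟩
  ∇ r q (+ r ℤ.- (a ℤ.- + 1)) ℤ.- ∇ r q (+ r ℤ.- a)
    ≡⟨ cong₂ ℤ._-_ (∇-odd odd r (a ℤ.- + 1)) (∇-odd odd r a) ⟩
  sign r ℤ.* ∇ r q (a ℤ.- + 1) ℤ.- sign r ℤ.* ∇ r q a
    ≡⟨ ℤS.solve 3 (λ s x y → s :* y :- s :* x := (:- s) :* (x :- y)) refl (sign r) (∇ r q a) (∇ r q (a ℤ.- + 1)) ⟩
  ℤ.- sign r ℤ.* (∇ r q a ℤ.- ∇ r q (a ℤ.- + 1)) ∎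
  where open ℤS

sign-even : ∀ M → sign (M ℕ.+ M) ≡ -[1+ 0 ]
sign-even zero    = refl
sign-even (suc M) rewrite ℕₚ.+-suc M M = trans (ℤₚ.neg-involutive (sign (M ℕ.+ M))) (sign-even M)

i≡-i⇒i≡0 : ∀ i → i ≡ ℤ.- i → i ≡ + 0
i≡-i⇒i≡0 (+ zero) _ = refl

-- The value at which the κ-term of ad-φ would otherwise contribute; this is where oddness of
-- the power sums enters.
∇-centre : ∀ {q} → Odd q → ∀ M → ∇ (M ℕ.+ M) q (+ M) ≡ + 0
∇-centre {q} odd M = i≡-i⇒i≡0 _ (begin
  ∇ (M ℕ.+ M) q (+ M)                        ≡⟨ cong (∇ (M ℕ.+ M) q) (ℤS.solve 1 (λ m → m := (m :+ m) :- m) refl (+ M)) ⟩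
  ∇ (M ℕ.+ M) q (+ (M ℕ.+ M) ℤ.- + M)        ≡⟨ ∇-odd odd (M ℕ.+ M) (+ M) ⟩
  sign (M ℕ.+ M) ℤ.* ∇ (M ℕ.+ M) q (+ M)     ≡⟨ cong (ℤ._* ∇ (M ℕ.+ M) q (+ M)) (sign-even M) ⟩
  -[1+ 0 ] ℤ.* ∇ (M ℕ.+ M) q (+ M)           ≡⟨ ℤₚ.-1*i≡-i _ ⟩
  ℤ.- ∇ (M ℕ.+ M) q (+ M)                    ∎)
  where open ℤS

κ-support : ∀ M i → κ M i ≡ 0ℚ ⊎ i ≡ M ℕ.+ M
κ-support zero    zero          = inj₂ refl
κ-support zero    (suc i)       = inj₁ refl
κ-support (suc M) zero          = inj₁ refl
κ-support (suc M) (suc zero)    = inj₁ refl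
κ-support (suc M) (suc (suc i)) with κ-support M i
... | inj₁ κ≡0 = inj₁ (cong ℚ.-_ κ≡0)
... | inj₂ eq  = inj₂ (trans (cong (λ z → suc (suc z)) eq) (cong suc (sym (ℕₚ.+-suc M M))))

-- The only r at which `κ M r` can be nonzero is 2M, and there the difference vanishes by symmetry.
∇-κ : ∀ {q} → Odd q → ∀ M r → ι (∇ r q (+ M)) ℚ.* κ M r ≡ 0ℚ
∇-κ {q} odd M r with κ-support M r
... | inj₁ κ≡0  = trans (cong (ι (∇ r q (+ M)) ℚ.*_) κ≡0) (ℚₚ.*-zeroʳ (ι (∇ r q (+ M))))
... | inj₂ refl = trans (cong (λ z → ι z ℚ.* κ M r) (∇-centre odd M)) (ℚₚ.*-zeroˡ (κ M r))

const#-∇ : ∀ q r M → const# M (ι (∇ r q (+ suc M))) + - const# M (ι (∇ r q (+ M))) ≡ const# M (ι (∇ (suc r) q (+ suc M)))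
const#-∇ q r M = begin
  const# M (ι x) + - const# M (ι y)        ≡⟨ cong (λ z → const# M (ι x) + z) (trans (cong (const# M) (ι-- y)) (const#-- M (ι y))) ⟨
  const# M (ι x) + const# M (ι (ℤ.- y))    ≡⟨ const#-+ M (ι x) (ι (ℤ.- y)) ⟨
  const# M (ι x ℚ.+ ι (ℤ.- y))             ≡⟨ cong (const# M) (ι-+ x (ℤ.- y)) ⟨
  const# M (ι (x ℤ.- y))                   ∎
  where
    x = ∇ r q (+ suc M)
    y = ∇ r q (+ M)

module _ (q : ℤ → ℤ) where

  -- ad 0 multiplies by Σ q(λᵢ), and ad r is its r-fold commutator with d (see ad-d).
  ad : ∀ {M} → ℕ → V M → V M
  ad r       (leaf _)           = 0#
  ad zero    (node {M} F G) = node (ad 0 F) (ad 0 G + ι (q (+ suc M)) · G)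
  ad (suc r) (node {M} F G) = node (ad (suc r) F) (ad (suc r) G + ι (∇ (suc r) q (+ suc M)) · φ r F)

  ad-+ : ∀ {M} r (F G : V M) → ad r (F + G) ≡ ad r F + ad r G
  ad-+ r (leaf _) (leaf _) = refl
  ad-+ {suc M} zero (node F G) (node H K) = cong₂ node (ad-+ 0 F H) (begin
    ad 0 (G + K) + c * (G + K)             ≡⟨ cong (_+ c * (G + K)) (ad-+ 0 G K) ⟩
    (ad 0 G + ad 0 K) + c * (G + K)        ≡⟨ solve 5 (λ a b c G K → (a :+ b) :+ c :* (G :+ K) := (a :+ c :* G) :+ (b :+ c :* K)) refl (ad 0 G) (ad 0 K) c G K ⟩
    (ad 0 G + c * G) + (ad 0 K + c * K)    ∎)
    where open VS M
          c = const# M (ι (q (+ suc M)))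
  ad-+ {suc M} (suc r) (node F G) (node H K) = cong₂ node (ad-+ (suc r) F H) (begin
    ad (suc r) (G + K) + c * φ r (F + H)             ≡⟨ cong₂ (λ a b → a + c * b) (ad-+ (suc r) G K) (φ-+ r F H) ⟩
    (ad (suc r) G + ad (suc r) K) + c * (φ r F + φ r H) ≡⟨ solve 5 (λ a b c G K → (a :+ b) :+ c :* (G :+ K) := (a :+ c :* G) :+ (b :+ c :* K)) refl (ad (suc r) G) (ad (suc r) K) c (φ r F) (φ r H) ⟩
    (ad (suc r) G + c * φ r F) + (ad (suc r) K + c * φ r H)    ∎)
    where open VS M
          c = const# M (ι (∇ (suc r) q (+ suc M)))

  module _ (odd : Odd q) where

    -- Commuting a quadratic expression in fermions with φ_M leaves a single fermion. The κ-term
    -- inside `φ r` on the right has no counterpart on the left, so its coefficient has to vanish: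
    -- this is `∇-κ`, and on a leaf q(0) = 0.
    ad-φ : ∀ {M} r (F : V M) → ad r (φ 0 F) ≡ φ 0 (ad r F) + - (ι (∇ r q (+ M)) · φ r F)
    ad-φ zero (leaf a) = cong leaf (begin
      0ℚ                            ≡⟨ ℚS.solve 1 (λ a → con 0ℚ := con 0ℚ :+ :- (con 0ℚ :* a)) refl a ⟩
      0ℚ ℚ.+ ℚ.- (0ℚ ℚ.* a)         ≡⟨ cong (λ z → 0ℚ ℚ.+ ℚ.- (ι z ℚ.* a)) (∇-centre odd 0) ⟨
      0ℚ ℚ.+ ℚ.- (ι (q (+ 0)) ℚ.* a) ∎)
      where open ℚS
    ad-φ (suc r) (leaf a) = cong leaf (ℚS.solve 1 (λ a → con 0ℚ := con 0ℚ :+ :- (a :* con 0ℚ)) refl (ι (∇ (suc r) q (+ 0))))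
      where open ℚS
    ad-φ {suc M} zero (node F G) = cong₂ node
      (solve 3 (λ a c G → a := (a :+ c :* G) :+ :- (c :* G)) refl (ad 0 G) c G)
      (begin
        ad 0 0# + c * 0#  ≡⟨ cong (_+ c * 0#) (additive⇒0 (ad 0) (ad-+ 0)) ⟩
        0# + c * 0#       ≡⟨ solve 1 (λ c → con 0ℚ :+ c :* con 0ℚ := con 0ℚ :+ :- (c :* con 0ℚ)) refl c ⟩
        0# + - (c * 0#)   ∎)
      where open VS M
            c = const# M (ι (q (+ suc M)))
    ad-φ {suc M} (suc r) (node F G) = cong₂ node
      (solve 3 (λ a c f → a := (a :+ c :* f) :+ :- (c :* f)) refl (ad (suc r) G) c (φ r F))
      (begin
        ad (suc r) 0# + c * φ r G         ≡⟨ cong (_+ c * φ r G) (additive⇒0 (ad (suc r)) (ad-+ (suc r))) ⟩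
        0# + c * φ r G                    ≡⟨ solve 3 (λ c g F → con 0ℚ :+ c :* g := con 0ℚ :+ (:- (con 0ℚ :* F) :+ c :* g)) refl c (φ r G) F ⟩
        0# + (- (0# * F) + c * φ r G)     ≡⟨ cong (λ z → 0# + (- (z * F) + c * φ r G)) (trans (cong (const# M) (sym (∇-κ odd (suc M) (suc r)))) (const#-* M (ι (∇ (suc r) q (+ suc M))) (κ (suc M) (suc r)))) ⟩
        0# + (- ((c * k) * F) + c * φ r G) ≡⟨ solve 4 (λ c k g F → con 0ℚ :+ (:- ((c :* k) :* F) :+ c :* g) := con 0ℚ :+ :- (c :* (k :* F :+ :- g))) refl c k (φ r G) F ⟩
        0# + - (c * (k * F + - φ r G))    ∎)
      where open VS M
            c = const# M (ι (∇ (suc r) q (+ suc M)))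
            k = const# M (κ (suc M) (suc r))

    -- At the top part M + 1 the fermion is lowered in two ways: `φ-d` (for r = 0, the summand
    -- `φ 0 F` of `d`) gives the coefficient at M + 1, and `ad-φ` gives minus the one at M. Together
    -- they form the next difference.
    ad-d : ∀ {M} r (F : V M) → ad r (d F) ≡ d (ad r F) + ad (suc r) F
    ad-d r (leaf a) = refl
    ad-d {suc M} zero (node F G) = cong₂ node (ad-d 0 F) (begin
      ad 0 (d G + φ 0 F) + c * (d G + φ 0 F)
        ≡⟨ cong (_+ c * (d G + φ 0 F)) (trans (ad-+ 0 (d G) (φ 0 F)) (cong₂ _+_ (ad-d 0 G) (ad-φ 0 F))) ⟩
      ((d (ad 0 G) + ad 1 G) + (φ 0 (ad 0 F) + - (c₀ * φ 0 F))) + c * (d G + φ 0 F)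
        ≡⟨ solve 7 (λ a b e c₀ c f g → ((a :+ b) :+ (e :+ :- (c₀ :* f))) :+ c :* (g :+ f) := ((a :+ c :* g) :+ e) :+ (b :+ (c :+ :- c₀) :* f)) refl
             (d (ad 0 G)) (ad 1 G) (φ 0 (ad 0 F)) c₀ c (φ 0 F) (d G) ⟩
      ((d (ad 0 G) + c * d G) + φ 0 (ad 0 F)) + (ad 1 G + (c + - c₀) * φ 0 F)
        ≡⟨ cong₂ (λ a b → (a + φ 0 (ad 0 F)) + (ad 1 G + b * φ 0 F))
             (trans (cong (λ z → d (ad 0 G) + z) (sym (d-· (ι (q (+ suc M))) G))) (sym (d-+ (ad 0 G) (c * G))))
             (const#-∇ q 0 M) ⟩
      (d (ad 0 G + c * G) + φ 0 (ad 0 F)) + (ad 1 G + ι (∇ 1 q (+ suc M)) · φ 0 F) ∎)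
      where
        open VS M
        c = const# M (ι (q (+ suc M)))
        c₀ = const# M (ι (q (+ M)))
    ad-d {suc M} (suc r) (node F G) = cong₂ node (ad-d (suc r) F) (begin
      ad (suc r) (d G + φ 0 F) + c * φ r (d F)
        ≡⟨ cong₂ (λ a b → a + c * b) (trans (ad-+ (suc r) (d G) (φ 0 F)) (cong₂ _+_ (ad-d (suc r) G) (ad-φ (suc r) F))) (φ-d r F) ⟩
      ((d (ad (suc r) G) + ad (suc (suc r)) G) + (φ 0 (ad (suc r) F) + - (c₀ * φ (suc r) F))) + c * (d (φ r F) + φ (suc r) F)
        ≡⟨ solve 7 (λ a b e c₀ c f g → ((a :+ b) :+ (e :+ :- (c₀ :* f))) :+ c :* (g :+ f) := ((a :+ c :* g) :+ e) :+ (b :+ (c :+ :- c₀) :* f)) refl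
             (d (ad (suc r) G)) (ad (suc (suc r)) G) (φ 0 (ad (suc r) F)) c₀ c (φ (suc r) F) (d (φ r F)) ⟩
      ((d (ad (suc r) G) + c * d (φ r F)) + φ 0 (ad (suc r) F)) + (ad (suc (suc r)) G + (c + - c₀) * φ (suc r) F)
        ≡⟨ cong₂ (λ a b → (a + φ 0 (ad (suc r) F)) + (ad (suc (suc r)) G + b * φ (suc r) F))
             (trans (cong (λ z → d (ad (suc r) G) + z) (sym (d-· (ι (∇ (suc r) q (+ suc M))) (φ r F)))) (sym (d-+ (ad (suc r) G) (c * φ r F))))
             (const#-∇ q (suc r) M) ⟩
      (d (ad (suc r) G + c * φ r F) + φ 0 (ad (suc r) F)) + (ad (suc (suc r)) G + ι (∇ (suc (suc r)) q (+ suc M)) · φ (suc r) F) ∎)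
      where
        open VS M
        c = const# M (ι (∇ (suc r) q (+ suc M)))
        c₀ = const# M (ι (∇ (suc r) q (+ M)))

  ad-vanish : ∀ {r} → (∀ a → ∇ (suc r) q a ≡ + 0) → ∀ {M} (F : V M) → ad (suc r) F ≡ 0#
  ad-vanish ∇≡0 (leaf _) = refl
  ad-vanish {r} ∇≡0 (node {M} F G) = cong₂ node (ad-vanish ∇≡0 F) (begin
    ad (suc r) G + ι (∇ (suc r) q (+ suc M)) · φ r F ≡⟨ cong₂ (λ a b → a + ι b · φ r F) (ad-vanish ∇≡0 G) (∇≡0 (+ suc M)) ⟩
    0# + 0# * φ r F ≡⟨ solve 1 (λ f → con 0ℚ :+ con 0ℚ :* f := con 0ℚ) refl (φ r F) ⟩
    0# ∎)
    where open VS M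

-- Operators that are ad-nilpotent with respect to box removal

Additive : ∀ {M} → (V M → V M) → Set
Additive X = ∀ F G → X (F + G) ≡ X F + X G

-- Nil s X: the s-fold commutator of X with d vanishes.
Nil : ∀ {M} → ℕ → (V M → V M) → Set
Nil zero    X = ∀ F → X F ≡ 0#
Nil (suc s) X = ∃ λ X′ → Additive X′ × (∀ F → X (d F) ≡ d (X F) + X′ F) × Nil s X′

-- Takes the place of function extensionality when an operator is replaced by a pointwise equal one.
Nil-resp : ∀ {M} s {X Y : V M → V M} → (∀ F → X F ≡ Y F) → Nil s X → Nil s Y
Nil-resp zero    X≗Y X≗0 F = trans (sym (X≗Y F)) (X≗0 F)
Nil-resp (suc s) X≗Y (X′ , X′-+ , Xd , nil) =
  X′ , X′-+ , (λ F → trans (sym (X≗Y (d F))) (trans (Xd F) (cong (λ z → d z + X′ F) (X≗Y F)))) , nil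

Nil-0 : ∀ {M} s {X : V M → V M} → (∀ F → X F ≡ 0#) → Nil s X
Nil-0 zero    X≗0 = X≗0
Nil-0 {M} (suc s) {X} X≗0 = (λ _ → 0#) , (λ _ _ → sym (+-identityˡ 0#)) , Xd , Nil-0 s (λ _ → refl)
  where
    open VS M
    Xd : ∀ F → X (d F) ≡ d (X F) + 0#
    Xd F = begin
      X (d F)       ≡⟨ X≗0 (d F) ⟩
      0#            ≡⟨ additive⇒0 d d-+ ⟨
      d 0#          ≡⟨ cong d (X≗0 F) ⟨
      d (X F)       ≡⟨ solve 1 (λ a → a := a :+ con 0ℚ) refl (d (X F)) ⟩
      d (X F) + 0#  ∎

Nil-≤ : ∀ {M s t} {X : V M → V M} → s ℕ.≤ t → Nil s X → Nil t X
Nil-≤ {t = t} ℕ.z≤n X≗0 = Nil-0 t X≗0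
Nil-≤ (ℕ.s≤s s≤t) (X′ , X′-+ , Xd , nil) = X′ , X′-+ , Xd , Nil-≤ s≤t nil

additive-+ : ∀ {M} {X Y : V M → V M} → Additive X → Additive Y → Additive (λ F → X F + Y F)
additive-+ {M} {X} {Y} X-+ Y-+ F G = trans (cong₂ _+_ (X-+ F G) (Y-+ F G))
  (solve 4 (λ a b c e → (a :+ b) :+ (c :+ e) := (a :+ c) :+ (b :+ e)) refl (X F) (X G) (Y F) (Y G))
  where open VS M

additive-∘ : ∀ {M} {X Y : V M → V M} → Additive X → Additive Y → Additive (λ F → X (Y F))
additive-∘ {X = X} {Y} X-+ Y-+ F G = trans (cong X (Y-+ F G)) (X-+ (Y F) (Y G))

Nil-+ : ∀ {M} s {X Y : V M → V M} → Nil s X → Nil s Y → Nil s (λ F → X F + Y F)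
Nil-+ zero    X≗0 Y≗0 F = trans (cong₂ _+_ (X≗0 F) (Y≗0 F)) (+-identityˡ 0#)
Nil-+ {M} (suc s) {X} {Y} (X′ , X′-+ , Xd , nilX) (Y′ , Y′-+ , Yd , nilY) =
  (λ F → X′ F + Y′ F) , additive-+ X′-+ Y′-+ , commutes , Nil-+ s nilX nilY
  where
    open VS M
    commutes : ∀ F → X (d F) + Y (d F) ≡ d (X F + Y F) + (X′ F + Y′ F)
    commutes F = begin
      X (d F) + Y (d F)                        ≡⟨ cong₂ _+_ (Xd F) (Yd F) ⟩
      (d (X F) + X′ F) + (d (Y F) + Y′ F)      ≡⟨ solve 4 (λ a b c e → (a :+ b) :+ (c :+ e) := (a :+ c) :+ (b :+ e)) refl (d (X F)) (X′ F) (d (Y F)) (Y′ F) ⟩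
      (d (X F) + d (Y F)) + (X′ F + Y′ F)      ≡⟨ cong (_+ (X′ F + Y′ F)) (d-+ (X F) (Y F)) ⟨
      d (X F + Y F) + (X′ F + Y′ F)            ∎

-- Leibniz rule: [XY , d] = [X , d] Y + X [Y , d], and in each summand one of the two orders has
-- dropped by one.
Nil-∘ : ∀ {M} s t {X Y : V M → V M} → Additive X → Additive Y → Nil s X → Nil t Y → Nil (s ℕ.+ t) (λ F → X (Y F))
Nil-∘ zero    t {Y = Y} _ _ X≗0 _ = Nil-0 t (λ F → X≗0 (Y F))
Nil-∘ (suc s) zero {X} X-+ _ _ Y≗0 = Nil-0 (suc s ℕ.+ 0) (λ F → trans (cong X (Y≗0 F)) (additive⇒0 X X-+))
Nil-∘ {M} (suc s) (suc t) {X} {Y} X-+ Y-+ nilX@(X′ , X′-+ , Xd , nilX′) nilY@(Y′ , Y′-+ , Yd , nilY′) =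
  (λ F → X′ (Y F) + X (Y′ F)) , additive-+ (additive-∘ X′-+ Y-+) (additive-∘ X-+ Y′-+) , commutes ,
  Nil-+ (s ℕ.+ suc t) (Nil-∘ s (suc t) X′-+ Y-+ nilX′ nilY)
    (subst (λ z → Nil z (λ F → X (Y′ F))) (sym (ℕₚ.+-suc s t)) (Nil-∘ (suc s) t X-+ Y′-+ nilX nilY′))
  where
    commutes : ∀ F → X (Y (d F)) ≡ d (X (Y F)) + (X′ (Y F) + X (Y′ F))
    commutes F = begin
      X (Y (d F))                               ≡⟨ cong X (Yd F) ⟩
      X (d (Y F) + Y′ F)                        ≡⟨ X-+ (d (Y F)) (Y′ F) ⟩
      X (d (Y F)) + X (Y′ F)                    ≡⟨ cong (_+ X (Y′ F)) (Xd (Y F)) ⟩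
      (d (X (Y F)) + X′ (Y F)) + X (Y′ F)       ≡⟨ +-assoc (d (X (Y F))) (X′ (Y F)) (X (Y′ F)) ⟩
      d (X (Y F)) + (X′ (Y F) + X (Y′ F))       ∎

Nil-ad : ∀ {q} → Odd q → ∀ {M} s r → (∀ (F : V M) → ad q (s ℕ.+ r) F ≡ 0#) → Nil {M} s (ad q r)
Nil-ad odd zero    r ad≗0 = ad≗0
Nil-ad {q} odd {M} (suc s) r ad≗0 = ad q (suc r) , ad-+ q (suc r) , ad-d q odd r ,
  Nil-ad odd s (suc r) (λ F → trans (cong (λ z → ad q z F) (ℕₚ.+-suc s r)) (ad≗0 F))

-- Supersymmetric functions as multiplication operators

tab : ∀ M → (List ℕ → ℚ) → V M
tab zero    h = leaf (h [])
tab (suc M) h = node (tab M h) (tab M (λ s → h (suc M ∷ s)))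

tab-const : ∀ M c → tab M (λ _ → c) ≡ const# M c
tab-const zero    c = refl
tab-const (suc M) c = cong₂ node (tab-const M c) (tab-const M c)

tab-+ : ∀ M f h → tab M (λ s → f s ℚ.+ h s) ≡ tab M f + tab M h
tab-+ zero    f h = refl
tab-+ (suc M) f h = cong₂ node (tab-+ M f h) (tab-+ M _ _)

tab-* : ∀ M f h → tab M (λ s → f s ℚ.* h s) ≡ tab M f * tab M h
tab-* zero    f h = refl
tab-* (suc M) f h = cong₂ node (tab-* M f h) (tab-* M _ _)

tab-cong : ∀ M {f h : List ℕ → ℚ} → (∀ s → f s ≡ h s) → tab M f ≡ tab M h
tab-cong zero    f≗h = cong leaf (f≗h [])
tab-cong (suc M) f≗h = cong₂ node (tab-cong M f≗h) (tab-cong M (λ s → f≗h (suc M ∷ s)))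

pos-^ : ∀ m r → + (m ℕ.^ r) ≡ (+ m) ℤ.^ r
pos-^ m zero    = refl
pos-^ m (suc r) = trans (ℤₚ.pos-* m (m ℕ.^ r)) (cong ((+ m) ℤ.*_) (pos-^ m r))

tab-powerSum : ∀ r M (F : V M) → tab M (powerSum (suc r)) * F ≡ ad (ℤ._^ suc r) 0 F
tab-powerSum r zero    (leaf a)   = cong leaf (ℚₚ.*-zeroˡ a)
tab-powerSum r (suc M) (node F G) = cong₂ node (tab-powerSum r M F) (begin
  tab M (λ s → powerSum (suc r) (suc M ∷ s)) * G
    ≡⟨ cong (_* G) (tab-cong M (λ s → trans (ℕ→ℚ-+ (suc M ℕ.^ suc r) _) (cong (λ z → ι z ℚ.+ powerSum (suc r) s) (pos-^ (suc M) (suc r))))) ⟩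
  tab M (λ s → c ℚ.+ powerSum (suc r) s) * G
    ≡⟨ cong (_* G) (trans (tab-+ M (λ _ → c) (powerSum (suc r))) (cong (_+ tab M (powerSum (suc r))) (tab-const M c))) ⟩
  (const# M c + tab M (powerSum (suc r))) * G
    ≡⟨ solve 3 (λ c p G → (c :+ p) :* G := p :* G :+ c :* G) refl (const# M c) (tab M (powerSum (suc r))) G ⟩
  tab M (powerSum (suc r)) * G + c · G
    ≡⟨ cong (_+ c · G) (tab-powerSum r M G) ⟩
  ad (ℤ._^ suc r) 0 G + c · G ∎)
  where
    open VS M
    c = ι ((+ suc M) ℤ.^ suc r)

-- A power sum of degree 2k + 1 dies after 2k + 2 differences. In the clause for `⊕` the sum stands
-- in for the maximum, as a common bound is enough.
nilBound : ΓExpr → ℕ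
nilBound (const _) = 1
nilBound (podd k)  = suc (suc (2 ℕ.* k))
nilBound (f ⊕ h)   = nilBound f ℕ.+ nilBound h
nilBound (f ⊗ h)   = nilBound f ℕ.+ nilBound h

*-additive : ∀ {M} (P : V M) → Additive (P *_)
*-additive {M} P F G = solve 3 (λ P F G → P :* (F :+ G) := P :* F :+ P :* G) refl P F G
  where open VS M

Nil-evalΓ : ∀ f M → Nil {M} (nilBound f) (tab M (evalΓ f) *_)
Nil-evalΓ (const c) M = Nil-resp 1 (λ F → cong (_* F) (sym (tab-const M c)))
  ((λ _ → 0#) , (λ _ _ → sym (+-identityˡ 0#)) ,
   (λ F → trans (sym (d-· c F)) (solve 1 (λ a → a := a :+ con 0ℚ) refl (d (c · F)))) , (λ _ → refl))
  where open VS M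
Nil-evalΓ (podd k) M = Nil-resp (suc (suc (2 ℕ.* k))) (λ F → sym (tab-powerSum (2 ℕ.* k) M F))
  (Nil-ad (^-odd k) (suc (suc (2 ℕ.* k))) 0
    (λ F → trans (cong (λ z → ad (ℤ._^ suc (2 ℕ.* k)) z F) (ℕₚ.+-identityʳ (suc (suc (2 ℕ.* k)))))
                 (ad-vanish _ {suc (2 ℕ.* k)} (∇-^ (suc (2 ℕ.* k))) F)))
Nil-evalΓ (f ⊕ h) M = Nil-resp s+t (λ F → trans (sym (*-distribʳ-+ F (tab M (evalΓ f)) (tab M (evalΓ h)))) (cong (_* F) (sym (tab-+ M (evalΓ f) (evalΓ h)))))
  (Nil-+ s+t (Nil-≤ (ℕₚ.m≤m+n (nilBound f) (nilBound h)) (Nil-evalΓ f M)) (Nil-≤ (ℕₚ.m≤n+m (nilBound h) (nilBound f)) (Nil-evalΓ h M)))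
  where s+t = nilBound f ℕ.+ nilBound h
Nil-evalΓ (f ⊗ h) M = Nil-resp (nilBound f ℕ.+ nilBound h)
  (λ F → trans (sym (*-assoc (tab M (evalΓ f)) (tab M (evalΓ h)) F)) (cong (_* F) (sym (tab-* M (evalΓ f) (evalΓ h)))))
  (Nil-∘ (nilBound f) (nilBound h) (*-additive _) (*-additive _) (Nil-evalΓ f M) (Nil-evalΓ h M))

-- Iterated differences of expectations

Δ : ℕ → (ℕ → ℚ) → ℕ → ℚ
Δ zero    a n = a n
Δ (suc s) a n = Δ s (λ m → a (suc m) ℚ.- a m) n

δ : ∀ M → V M
δ zero    = leaf 1ℚ
δ (suc M) = node (δ M) 0#

-- By `γ-tab` this is g restricted to partitions of size n.
γ : ∀ M → ℕ → V M
γ M zero    = δ M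
γ M (suc n) = d (γ M n)

-- The offset k counts the commutators already taken. In a(m + 1) - a(m), moving `d` across X
-- produces `ε-d`, whose factor cancels against the factorials and removes the term a(m); what
-- remains has the same form with X replaced by its commutator and k by k + 1. The bound on M keeps
-- every index in use within the range of `ε-d`.
Δ-ε : ∀ {M} s {X : V M → V M} → Nil s X → ∀ k a →
      (∀ n → n ℕ.+ k ℕ.≤ M → a n ≡ 1/! (n ℕ.+ k) ℚ.* ε (n ℕ.+ k) (X (γ M n))) →
      ∀ n → s ℕ.+ (n ℕ.+ k) ℕ.≤ M → Δ s a n ≡ 0ℚ
Δ-ε {M} zero {X} X≗0 k a a-ε n n+k≤M = begin
  a n                                            ≡⟨ a-ε n n+k≤M ⟩
  1/! (n ℕ.+ k) ℚ.* ε (n ℕ.+ k) (X (γ M n))      ≡⟨ cong (1/! (n ℕ.+ k) ℚ.*_) (trans (cong (ε (n ℕ.+ k)) (X≗0 (γ M n))) (ε-0 {M} (n ℕ.+ k))) ⟩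
  1/! (n ℕ.+ k) ℚ.* 0ℚ                           ≡⟨ ℚₚ.*-zeroʳ (1/! (n ℕ.+ k)) ⟩
  0ℚ                                             ∎
Δ-ε {M} (suc s) {X} (X′ , X′-+ , Xd , nil) k a a-ε n n+k≤M =
  Δ-ε s nil (suc k) _ step n (subst (ℕ._≤ M) (sym (trans (cong (s ℕ.+_) (ℕₚ.+-suc n k)) (ℕₚ.+-suc s (n ℕ.+ k)))) n+k≤M)
  where
    step : ∀ m → m ℕ.+ suc k ℕ.≤ M → a (suc m) ℚ.- a m ≡ 1/! (m ℕ.+ suc k) ℚ.* ε (m ℕ.+ suc k) (X′ (γ M m))
    step m m+k<M rewrite ℕₚ.+-suc m k = begin
      a (suc m) ℚ.- a m
        ≡⟨ cong₂ ℚ._-_ (a-ε (suc m) m+k<M) (a-ε m (ℕₚ.<⇒≤ m+k<M)) ⟩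
      1/! (suc j) ℚ.* ε (suc j) (X (d G)) ℚ.- 1/! j ℚ.* ε j (X G)
        ≡⟨ cong₂ (λ x y → 1/! (suc j) ℚ.* x ℚ.- y ℚ.* ε j (X G))
             (trans (cong (ε (suc j)) (Xd G)) (trans (ε-+ (suc j) (d (X G)) (X′ G)) (cong (ℚ._+ ε (suc j) (X′ G)) (ε-d j (X G) m+k<M))))
             (sym (1/!-suc j)) ⟩
      1/! (suc j) ℚ.* (ℕ→ℚ (suc j) ℚ.* ε j (X G) ℚ.+ ε (suc j) (X′ G)) ℚ.- (ℕ→ℚ (suc j) ℚ.* 1/! (suc j)) ℚ.* ε j (X G)
        ≡⟨ solve 4 (λ i n e e′ → i :* (n :* e :+ e′) :- (n :* i) :* e := i :* e′) refl (1/! (suc j)) (ℕ→ℚ (suc j)) (ε j (X G)) (ε (suc j) (X′ G)) ⟩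
      1/! (suc j) ℚ.* ε (suc j) (X′ G) ∎
      where
        open ℚS
        j = m ℕ.+ k
        G = γ M m

-- Sequences with a vanishing iterated difference

binom : ℕ → ℕ → ℚ
binom zero    n       = 1ℚ
binom (suc j) zero    = 0ℚ
binom (suc j) (suc n) = binom j n ℚ.+ binom (suc j) n

-- A Newton series whose first coefficient belongs to `binom j`; the index j lets the tail of the
-- list be again such a series.
newton : List ℚ → ℕ → ℕ → ℚ
newton []       j n = 0ℚ
newton (c ∷ cs) j n = c ℚ.* binom j n ℚ.+ newton cs (suc j) n

newton-zero : ∀ cs j → newton cs (suc j) 0 ≡ 0ℚ
newton-zero []       j = refl
newton-zero (c ∷ cs) j = trans (cong₂ ℚ._+_ (ℚₚ.*-zeroʳ c) (newton-zero cs (suc j))) (ℚₚ.+-identityˡ 0ℚ)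

newton-suc : ∀ cs j n → newton cs (suc j) (suc n) ≡ newton cs (suc j) n ℚ.+ newton cs j n
newton-suc []       j n = sym (ℚₚ.+-identityˡ 0ℚ)
newton-suc (c ∷ cs) j n = trans (cong (c ℚ.* (binom j n ℚ.+ binom (suc j) n) ℚ.+_) (newton-suc cs (suc j) n))
  (solve 5 (λ c x y p q → c :* (x :+ y) :+ (p :+ q) := (c :* y :+ p) :+ (c :* x :+ q)) refl c (binom j n) (binom (suc j) n) (newton cs (suc (suc j)) n) (newton cs (suc j) n))
  where open ℚS

-- The coefficients are the iterated differences at 0: the expansion of the difference sequence is
-- shifted by one index and summed, with a(0) as constant term.
newton-expansion : ∀ s a → (∀ n → Δ s a n ≡ 0ℚ) → ∃ λ cs → ∀ n → a n ≡ newton cs 0 n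
newton-expansion zero    a Δa≡0 = [] , Δa≡0
newton-expansion (suc s) a Δa≡0 with newton-expansion s (λ m → a (suc m) ℚ.- a m) Δa≡0
... | cs , Δa≡ = a 0 ∷ cs , go
  where
    open ℚS
    go : ∀ n → a n ≡ a 0 ℚ.* 1ℚ ℚ.+ newton cs 1 n
    go zero    = trans (solve 1 (λ x → x := x :* con 1ℚ :+ con 0ℚ) refl (a 0)) (cong (a 0 ℚ.* 1ℚ ℚ.+_) (sym (newton-zero cs 0)))
    go (suc n) = begin
      a (suc n)                                              ≡⟨ solve 2 (λ x y → x := y :+ (x :- y)) refl (a (suc n)) (a n) ⟩
      a n ℚ.+ (a (suc n) ℚ.- a n)                            ≡⟨ cong₂ ℚ._+_ (go n) (Δa≡ n) ⟩
      (a 0 ℚ.* 1ℚ ℚ.+ newton cs 1 n) ℚ.+ newton cs 0 n       ≡⟨ ℚₚ.+-assoc (a 0 ℚ.* 1ℚ) (newton cs 1 n) (newton cs 0 n) ⟩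
      a 0 ℚ.* 1ℚ ℚ.+ (newton cs 1 n ℚ.+ newton cs 0 n)       ≡⟨ cong (a 0 ℚ.* 1ℚ ℚ.+_) (newton-suc cs 0 n) ⟨
      a 0 ℚ.* 1ℚ ℚ.+ newton cs 1 (suc n)                     ∎

IsPolynomial : (ℕ → ℚ) → Set
IsPolynomial a = ∃ λ Φ → ∀ n → a n ≡ evalPoly Φ (ℕ→ℚ n)

_+ₚ_ : List ℚ → List ℚ → List ℚ
[]       +ₚ q        = q
(a ∷ p)  +ₚ []       = a ∷ p
(a ∷ p)  +ₚ (b ∷ q)  = (a ℚ.+ b) ∷ (p +ₚ q)

+ₚ-eval : ∀ p q x → evalPoly (p +ₚ q) x ≡ evalPoly p x ℚ.+ evalPoly q x
+ₚ-eval []       q        x = sym (ℚₚ.+-identityˡ _)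
+ₚ-eval (a ∷ p)  []       x = sym (ℚₚ.+-identityʳ _)
+ₚ-eval (a ∷ p)  (b ∷ q)  x = trans (cong (λ z → (a ℚ.+ b) ℚ.+ x ℚ.* z) (+ₚ-eval p q x))
  (solve 5 (λ a b x p q → (a :+ b) :+ x :* (p :+ q) := (a :+ x :* p) :+ (b :+ x :* q)) refl a b x (evalPoly p x) (evalPoly q x))
  where open ℚS

scale-eval : ∀ c p x → evalPoly (map (c ℚ.*_) p) x ≡ c ℚ.* evalPoly p x
scale-eval c []      x = sym (ℚₚ.*-zeroʳ c)
scale-eval c (a ∷ p) x = trans (cong (λ z → c ℚ.* a ℚ.+ x ℚ.* z) (scale-eval c p x))
  (solve 4 (λ c a x p → c :* a :+ x :* (c :* p) := c :* (a :+ x :* p)) refl c a x (evalPoly p x))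
  where open ℚS

poly-+ : ∀ {a b} → IsPolynomial a → IsPolynomial b → IsPolynomial (λ n → a n ℚ.+ b n)
poly-+ (p , a≡p) (q , b≡q) = (p +ₚ q) , λ n → trans (cong₂ ℚ._+_ (a≡p n) (b≡q n)) (sym (+ₚ-eval p q (ℕ→ℚ n)))

poly-scale : ∀ c {a} → IsPolynomial a → IsPolynomial (λ n → c ℚ.* a n)
poly-scale c (p , a≡p) = map (c ℚ.*_) p , λ n → trans (cong (c ℚ.*_) (a≡p n)) (sym (scale-eval c p (ℕ→ℚ n)))

poly-n : ∀ {a} → IsPolynomial a → IsPolynomial (λ n → ℕ→ℚ n ℚ.* a n)
poly-n (p , a≡p) = 0ℚ ∷ p , λ n → trans (cong (ℕ→ℚ n ℚ.*_) (a≡p n)) (sym (ℚₚ.+-identityˡ _))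

-- Expresses `binom (suc j)` through `binom j` and a linear factor in n, which makes it a polynomial
-- by induction on j. The subtraction is in ℚ; for n < j both sides are zero.
binom-absorb : ∀ j n → ℕ→ℚ (suc j) ℚ.* binom (suc j) n ≡ (ℕ→ℚ n ℚ.- ℕ→ℚ j) ℚ.* binom j n
binom-absorb zero    zero    = refl
binom-absorb (suc j) zero    = trans (ℚₚ.*-zeroʳ (ℕ→ℚ (suc (suc j)))) (sym (ℚₚ.*-zeroʳ (ℕ→ℚ 0 ℚ.- ℕ→ℚ (suc j))))
binom-absorb zero    (suc n) = begin
  1ℚ ℚ.* (1ℚ ℚ.+ binom 1 n)        ≡⟨ ℚₚ.*-distribˡ-+ 1ℚ 1ℚ (binom 1 n) ⟩
  1ℚ ℚ.+ 1ℚ ℚ.* binom 1 n          ≡⟨ cong (1ℚ ℚ.+_) (binom-absorb zero n) ⟩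
  1ℚ ℚ.+ (ℕ→ℚ n ℚ.- 0ℚ) ℚ.* 1ℚ     ≡⟨ solve 1 (λ n → con 1ℚ :+ (n :- con 0ℚ) :* con 1ℚ := ((con 1ℚ :+ n) :- con 0ℚ) :* con 1ℚ) refl (ℕ→ℚ n) ⟩
  ((1ℚ ℚ.+ ℕ→ℚ n) ℚ.- 0ℚ) ℚ.* 1ℚ   ≡⟨ cong (λ z → (z ℚ.- 0ℚ) ℚ.* 1ℚ) (ℕ→ℚ-suc n) ⟨
  (ℕ→ℚ (suc n) ℚ.- 0ℚ) ℚ.* 1ℚ      ∎
  where open ℚS
binom-absorb (suc j) (suc n) = begin
  J₂ ℚ.* (y ℚ.+ binom (suc (suc j)) n)         ≡⟨ ℚₚ.*-distribˡ-+ J₂ y _ ⟩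
  J₂ ℚ.* y ℚ.+ J₂ ℚ.* binom (suc (suc j)) n    ≡⟨ cong₂ (λ a b → a ℚ.* y ℚ.+ b) (ℕ→ℚ-suc (suc j)) (binom-absorb (suc j) n) ⟩
  (1ℚ ℚ.+ J₁) ℚ.* y ℚ.+ (N ℚ.- J₁) ℚ.* y       ≡⟨ solve 3 (λ J N y → (con 1ℚ :+ J) :* y :+ (N :- J) :* y := (con 1ℚ :+ N :- J) :* y :+ J :* y) refl J₁ N y ⟩
  (1ℚ ℚ.+ N ℚ.- J₁) ℚ.* y ℚ.+ J₁ ℚ.* y         ≡⟨ cong₂ ℚ._+_ (cong (λ a → (a ℚ.- J₁) ℚ.* y) (sym (ℕ→ℚ-suc n))) (binom-absorb j n) ⟩
  (N₁ ℚ.- J₁) ℚ.* y ℚ.+ (N ℚ.- J₀) ℚ.* x        ≡⟨ cong (λ a → (N₁ ℚ.- J₁) ℚ.* y ℚ.+ a ℚ.* x) (trans (solve 2 (λ N J → N :- J := (con 1ℚ :+ N) :- (con 1ℚ :+ J)) refl N J₀) (cong₂ ℚ._-_ (sym (ℕ→ℚ-suc n)) (sym (ℕ→ℚ-suc j)))) ⟩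
  (N₁ ℚ.- J₁) ℚ.* y ℚ.+ (N₁ ℚ.- J₁) ℚ.* x      ≡⟨ solve 3 (λ a x y → a :* y :+ a :* x := a :* (x :+ y)) refl (N₁ ℚ.- J₁) x y ⟩
  (N₁ ℚ.- J₁) ℚ.* (x ℚ.+ y)                    ∎
  where
    open ℚS
    J₂ = ℕ→ℚ (suc (suc j))
    J₁ = ℕ→ℚ (suc j)
    J₀ = ℕ→ℚ j
    N₁ = ℕ→ℚ (suc n)
    N  = ℕ→ℚ n
    x  = binom j n
    y  = binom (suc j) n

poly-binom : ∀ j → IsPolynomial (binom j)
poly-binom zero    = 1ℚ ∷ [] , λ n → solve 1 (λ n → con 1ℚ := con 1ℚ :+ n :* con 0ℚ) refl (ℕ→ℚ n)
  where open ℚS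
poly-binom (suc j) with poly-scale (+ 1 ℚ./ suc j) (poly-+ (poly-n (poly-binom j)) (poly-scale (ℚ.- ℕ→ℚ j) (poly-binom j)))
... | Φ , eq = Φ , λ n → trans (rewrite-binom n) (eq n)
  where
    open ℚS
    1/j = + 1 ℚ./ suc j
    rewrite-binom : ∀ n → binom (suc j) n ≡ 1/j ℚ.* (ℕ→ℚ n ℚ.* binom j n ℚ.+ (ℚ.- ℕ→ℚ j) ℚ.* binom j n)
    rewrite-binom n = begin
      binom (suc j) n                               ≡⟨ ℚₚ.*-identityˡ _ ⟨
      1ℚ ℚ.* binom (suc j) n                        ≡⟨ cong (ℚ._* binom (suc j) n) (j*1/j) ⟨
      (ℕ→ℚ (suc j) ℚ.* 1/j) ℚ.* binom (suc j) n     ≡⟨ solve 3 (λ a b c → (a :* b) :* c := b :* (a :* c)) refl (ℕ→ℚ (suc j)) 1/j (binom (suc j) n) ⟩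
      1/j ℚ.* (ℕ→ℚ (suc j) ℚ.* binom (suc j) n)     ≡⟨ cong (1/j ℚ.*_) (binom-absorb j n) ⟩
      1/j ℚ.* ((ℕ→ℚ n ℚ.- ℕ→ℚ j) ℚ.* binom j n)     ≡⟨ solve 4 (λ a n j b → a :* ((n :- j) :* b) := a :* (n :* b :+ (:- j) :* b)) refl 1/j (ℕ→ℚ n) (ℕ→ℚ j) (binom j n) ⟩
      1/j ℚ.* (ℕ→ℚ n ℚ.* binom j n ℚ.+ (ℚ.- ℕ→ℚ j) ℚ.* binom j n) ∎
      where
        j*1/j : ℕ→ℚ (suc j) ℚ.* 1/j ≡ 1ℚ
        -- The denominator is rewritten as `suc j ℕ.* 1` to fit `cancel-/`.
        j*1/j = trans (cong (ℕ→ℚ (suc j) ℚ.*_) (cong (λ z → + 1 ℚ./ suc z) (sym (ℕₚ.*-identityʳ j)))) (cancel-/ (suc j) 1)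

poly-newton : ∀ cs j → IsPolynomial (newton cs j)
poly-newton []       j = [] , λ _ → refl
poly-newton (c ∷ cs) j = poly-+ (poly-scale c (poly-binom j)) (poly-newton cs (suc j))

Δ-vanishing⇒polynomial : ∀ s a → (∀ n → Δ s a n ≡ 0ℚ) → IsPolynomial a
Δ-vanishing⇒polynomial s a Δa≡0 with newton-expansion s a Δa≡0
... | cs , a≡ with poly-newton cs 0
... | Φ , eq = Φ , λ n → trans (a≡ n) (eq n)

-- Strict partitions and shifted diagrams

≤⇒≤ᵇ≡true : ∀ {m n} → m ℕ.≤ n → (m ≤ᵇ n) ≡ true
≤⇒≤ᵇ≡true {m} {n} = dec-true (m ℕₚ.≤? n)

≰⇒≤ᵇ≡false : ∀ {m n} → ¬ m ℕ.≤ n → (m ≤ᵇ n) ≡ false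
≰⇒≤ᵇ≡false {m} {n} = dec-false (m ℕₚ.≤? n)

if-true : ∀ {b} {x y : ℚ} → b ≡ true → (if b then x else y) ≡ x
if-true refl = refl

if-false : ∀ {b} {x y : ℚ} → b ≡ false → (if b then x else y) ≡ y
if-false refl = refl

≡⇒≡ᵇ≡true : ∀ {m n} → m ≡ n → (m ≡ᵇ n) ≡ true
≡⇒≡ᵇ≡true {m} {n} = dec-true (m ℕₚ.≟ n)

≢⇒≡ᵇ≡false : ∀ {m n} → ¬ m ≡ n → (m ≡ᵇ n) ≡ false
≢⇒≡ᵇ≡false {m} {n} = dec-false (m ℕₚ.≟ n)

infixr 5 _∷_
-- The bound is inclusive for parts: the head `suc a` is at most m, and all later parts are at most
-- a, hence strictly smaller than the head.
data StrictBelow : ℕ → List ℕ → Set where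
  []  : ∀ {m} → StrictBelow m []
  _∷_ : ∀ {m a λs} → a ℕ.< m → StrictBelow a λs → StrictBelow m (suc a ∷ λs)

weaken : ∀ {m n λs} → m ℕ.≤ n → StrictBelow m λs → StrictBelow n λs
weaken m≤n []         = []
weaken m≤n (a<m ∷ st) = ℕₚ.<-≤-trans a<m m≤n ∷ st

-- `tab` samples a function at strict partitions only, so identities that rely on strictness can be
-- used under it.
tab-cong-strict : ∀ M {f h : List ℕ → ℚ} → (∀ {s} → StrictBelow M s → f s ≡ h s) → tab M f ≡ tab M h
tab-cong-strict zero    f≡h = cong leaf (f≡h [])
tab-cong-strict (suc M) f≡h = cong₂ node (tab-cong-strict M (λ st → f≡h (weaken (ℕₚ.n≤1+n M) st)))
                                         (tab-cong-strict M (λ st → f≡h (ℕₚ.≤-refl ∷ st)))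

Σ : (List ℕ → ℚ) → List (List ℕ) → ℚ
Σ h xs = foldr ℚ._+_ 0ℚ (map h xs)

Σ-++ : ∀ h xs ys → Σ h (xs ++ ys) ≡ Σ h xs ℚ.+ Σ h ys
Σ-++ h []       ys = sym (ℚₚ.+-identityˡ _)
Σ-++ h (x ∷ xs) ys = trans (cong (h x ℚ.+_) (Σ-++ h xs ys)) (sym (ℚₚ.+-assoc (h x) (Σ h xs) (Σ h ys)))

Σ-cong : ∀ {f h} xs → (∀ {x} → x ∈ xs → f x ≡ h x) → Σ f xs ≡ Σ h xs
Σ-cong []       f≡h = refl
Σ-cong (x ∷ xs) f≡h = cong₂ ℚ._+_ (f≡h (here refl)) (Σ-cong xs (f≡h ∘ there))

Σ-0 : ∀ {f} xs → (∀ {x} → x ∈ xs → f x ≡ 0ℚ) → Σ f xs ≡ 0ℚ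
Σ-0 []       f≡0 = refl
Σ-0 (x ∷ xs) f≡0 = trans (cong₂ ℚ._+_ (f≡0 (here refl)) (Σ-0 xs (f≡0 ∘ there))) (ℚₚ.+-identityˡ 0ℚ)

Σ-*ˡ : ∀ c f xs → Σ (λ x → c ℚ.* f x) xs ≡ c ℚ.* Σ f xs
Σ-*ˡ c f []       = sym (ℚₚ.*-zeroʳ c)
Σ-*ˡ c f (x ∷ xs) = trans (cong (c ℚ.* f x ℚ.+_) (Σ-*ˡ c f xs)) (sym (ℚₚ.*-distribˡ-+ c (f x) (Σ f xs)))

Σ-sp-suc : ∀ h n m → Σ h (sp n (suc m)) ≡ Σ h (sp n m) ℚ.+ (if suc m ≤ᵇ n then Σ (h ∘ (suc m ∷_)) (sp (n ∸ suc m) m) else 0ℚ)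
Σ-sp-suc h zero    m = sym (ℚₚ.+-identityʳ _)
Σ-sp-suc h (suc n) m = trans (Σ-++ h (sp (suc n) m) _) (cong (Σ h (sp (suc n) m) ℚ.+_) (rest (suc m ≤ᵇ suc n)))
  where
    rest : ∀ b → Σ h (if b then map (suc m ∷_) (sp (n ∸ m) m) else []) ≡ (if b then Σ (h ∘ (suc m ∷_)) (sp (n ∸ m) m) else 0ℚ)
    rest false = refl
    rest true  = cong (foldr ℚ._+_ 0ℚ) (sym (Listₚ.map-∘ (sp (n ∸ m) m)))

sp-sound : ∀ n m {μ} → μ ∈ sp n m → StrictBelow m μ × size μ ≡ n
sp-sound zero    m       (here refl) = [] , refl
sp-sound (suc n) (suc m) μ∈ with ∈-++⁻ (sp (suc n) m) μ∈
... | inj₁ μ∈′ with sp-sound (suc n) m μ∈′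
...   | st , sz = weaken (ℕₚ.n≤1+n m) st , sz
sp-sound (suc n) (suc m) μ∈ | inj₂ μ∈′ with suc m ℕₚ.≤? suc n
... | no  m≰n rewrite ≰⇒≤ᵇ≡false m≰n with () ← μ∈′
... | yes m≤n rewrite ≤⇒≤ᵇ≡true m≤n with ∈-map⁻ (suc m ∷_) μ∈′
...   | μ′ , μ′∈ , refl with sp-sound (n ∸ m) m μ′∈
...     | st , sz = ℕₚ.≤-refl ∷ st , trans (cong (suc m ℕ.+_) sz) (ℕₚ.m+[n∸m]≡n m≤n)

sp-stable : ∀ n k → sp n (k ℕ.+ n) ≡ sp n n
sp-stable n       zero    = refl
sp-stable zero    (suc k) = refl
sp-stable (suc n) (suc k) rewrite ≰⇒≤ᵇ≡false (ℕₚ.<⇒≱ (ℕ.s≤s (ℕₚ.m≤n+m (suc n) k))) =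
  trans (Listₚ.++-identityʳ _) (sp-stable (suc n) k)

-- Containment of shifted diagrams, read off from the parts

_⊑ᵇ_ : List ℕ → List ℕ → Bool
[]      ⊑ᵇ _       = true
(_ ∷ _) ⊑ᵇ []      = false
(a ∷ μ) ⊑ᵇ (b ∷ λs) = (a ≤ᵇ b) ∧ (μ ⊑ᵇ λs)

all-true⁻ : ∀ {A : Set} (p : A → Bool) xs → all p xs ≡ true → ∀ {x} → x ∈ xs → p x ≡ true
all-true⁻ p (x ∷ xs) eq x∈ with p x in px | x∈
... | true | here refl = px
... | true | there x∈′ = all-true⁻ p xs eq x∈′

all-true⁺ : ∀ {A : Set} (p : A → Bool) xs → (∀ {x} → x ∈ xs → p x ≡ true) → all p xs ≡ true
all-true⁺ p []       p≡ = refl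
all-true⁺ p (x ∷ xs) p≡ rewrite p≡ (here refl) = all-true⁺ p xs (p≡ ∘ there)

eqBox-refl : ∀ x → eqBox x x ≡ true
eqBox-refl (a , b) = cong₂ _∧_ (≡⇒≡ᵇ≡true {a} refl) (≡⇒≡ᵇ≡true {b} refl)

eqBox⇒≡ : ∀ x y → eqBox x y ≡ true → x ≡ y
eqBox⇒≡ (a , b) (c , e) eq with a ℕₚ.≟ c | b ℕₚ.≟ e
... | yes refl | yes refl = refl
... | yes refl | no b≢e rewrite ≢⇒≡ᵇ≡false b≢e | Boolₚ.∧-zeroʳ (a ≡ᵇ a) with () ← eq
... | no a≢c   | _ rewrite ≢⇒≡ᵇ≡false a≢c with () ← eq

any-eqBox⁻ : ∀ x B → any (eqBox x) B ≡ true → x ∈ B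
any-eqBox⁻ x (y ∷ B) eq with eqBox x y in xy
... | true  = here (eqBox⇒≡ x y xy)
... | false = there (any-eqBox⁻ x B eq)

any-eqBox⁺ : ∀ {x} B → x ∈ B → any (eqBox x) B ≡ true
any-eqBox⁺ {x} (_ ∷ B) (here refl) rewrite eqBox-refl x = refl
any-eqBox⁺ {x} (y ∷ B) (there x∈) rewrite any-eqBox⁺ B x∈ = Boolₚ.∨-zeroʳ (eqBox x y)

row : ℕ → ℕ → List (ℕ × ℕ)
row i a = map (λ t → (i , i ℕ.+ t)) (upTo a)

shiftedFrom-row : ∀ i λs {x} → x ∈ shiftedFrom i λs → i ℕ.≤ proj₁ x
shiftedFrom-row i (a ∷ λs) x∈ with ∈-++⁻ (row i a) x∈
... | inj₁ x∈row with _ , _ , refl ← ∈-map⁻ (λ t → (i , i ℕ.+ t)) x∈row = ℕₚ.≤-refl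
... | inj₂ x∈′ = ℕₚ.<⇒≤ (shiftedFrom-row (suc i) λs x∈′)

⊑⇒⊆ : ∀ i μ λs → μ ⊑ᵇ λs ≡ true → ∀ {x} → x ∈ shiftedFrom i μ → x ∈ shiftedFrom i λs
⊑⇒⊆ i (a ∷ μ) (b ∷ λs) μ⊑λ x∈ with a ℕₚ.≤? b
... | no a≰b rewrite ≰⇒≤ᵇ≡false a≰b with () ← μ⊑λ
... | yes a≤b rewrite ≤⇒≤ᵇ≡true a≤b with ∈-++⁻ (row i a) x∈
...   | inj₂ x∈′ = ∈-++⁺ʳ (row i b) (⊑⇒⊆ (suc i) μ λs μ⊑λ x∈′)
...   | inj₁ x∈row with t , t∈ , refl ← ∈-map⁻ (λ t → (i , i ℕ.+ t)) x∈row =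
  ∈-++⁺ˡ (∈-map⁺ (λ t → (i , i ℕ.+ t)) (∈-upTo⁺ (ℕₚ.<-≤-trans (∈-upTo⁻ t∈) a≤b)))

-- The last box of row i of μ must lie in row i of λ, since all later rows have a larger first
-- coordinate. Such a box exists because the parts of a strict partition are positive.
⊆⇒⊑ : ∀ {m} i μ λs → StrictBelow m μ → (∀ {x} → x ∈ shiftedFrom i μ → x ∈ shiftedFrom i λs) → μ ⊑ᵇ λs ≡ true
⊆⇒⊑ i []          λs       _        _   = refl
⊆⇒⊑ i (suc a ∷ μ) []       (_ ∷ _)  μ⊆λ with () ← μ⊆λ (here refl)
⊆⇒⊑ i (suc a ∷ μ) (b ∷ λs) (_ ∷ st) μ⊆λ = cong₂ _∧_ (≤⇒≤ᵇ≡true a<b) (⊆⇒⊑ (suc i) μ λs st rest)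
  where
    a<b : a ℕ.< b
    a<b with ∈-++⁻ (row i b) (μ⊆λ (∈-++⁺ˡ (∈-map⁺ (λ t → (i , i ℕ.+ t)) (∈-upTo⁺ (ℕₚ.n<1+n a)))))
    ... | inj₂ ∈rest = ⊥-elim (ℕₚ.<-irrefl refl (shiftedFrom-row (suc i) λs ∈rest))
    ... | inj₁ ∈row with t , t∈ , eq ← ∈-map⁻ (λ t → (i , i ℕ.+ t)) ∈row =
      subst (ℕ._< b) (sym (ℕₚ.+-cancelˡ-≡ i a t (cong proj₂ eq))) (∈-upTo⁻ t∈)
    rest : ∀ {x} → x ∈ shiftedFrom (suc i) μ → x ∈ shiftedFrom (suc i) λs
    rest x∈ with ∈-++⁻ (row i b) (μ⊆λ (∈-++⁺ʳ (row i (suc a)) x∈))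
    ... | inj₂ ∈rest = ∈rest
    ... | inj₁ ∈row with _ , _ , refl ← ∈-map⁻ (λ t → (i , i ℕ.+ t)) ∈row =
      ⊥-elim (ℕₚ.<-irrefl refl (shiftedFrom-row (suc i) μ x∈))

S⊆ᵇS : ∀ {m μ} λs → StrictBelow m μ → (S μ ⊆ᵇ S λs) ≡ (μ ⊑ᵇ λs)
S⊆ᵇS {μ = μ} λs st = Boolₚ.⇔→≡ {z = true} (mk⇔
  (λ eq → ⊆⇒⊑ 1 μ λs st (λ {x} x∈ → any-eqBox⁻ x (S λs) (all-true⁻ _ (S μ) eq x∈)))
  (λ μ⊑λ → all-true⁺ _ (S μ) (λ {x} x∈ → any-eqBox⁺ (S λs) (⊑⇒⊆ 1 μ λs μ⊑λ x∈))))

⊑-size : ∀ μ λs → μ ⊑ᵇ λs ≡ true → size μ ℕ.≤ size λs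
⊑-size []      λs       _   = ℕ.z≤n
⊑-size (a ∷ μ) (b ∷ λs) μ⊑λ with a ℕₚ.≤? b
... | no a≰b rewrite ≰⇒≤ᵇ≡false a≰b with () ← μ⊑λ
... | yes a≤b rewrite ≤⇒≤ᵇ≡true a≤b = ℕₚ.+-mono-≤ a≤b (⊑-size μ λs μ⊑λ)

-- Sums over the strict partitions contained in a given one

Σ⊑ : ℕ → ℕ → List ℕ → (List ℕ → ℚ) → ℚ
Σ⊑ n m λs h = Σ (λ μ → if μ ⊑ᵇ λs then h μ else 0ℚ) (sp n m)

Σ⊑-suc-< : ∀ n m b λs h → b ℕ.≤ m → Σ⊑ n (suc m) (b ∷ λs) h ≡ Σ⊑ n m (b ∷ λs) h
Σ⊑-suc-< n m b λs h b≤m = trans (Σ-sp-suc _ n m) (trans (cong (Σ⊑ n m (b ∷ λs) h ℚ.+_) (vanish (suc m ≤ᵇ n))) (ℚₚ.+-identityʳ _))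
  where
    vanish : ∀ c → (if c then Σ (λ μ → if (suc m ≤ᵇ b) ∧ (μ ⊑ᵇ λs) then h (suc m ∷ μ) else 0ℚ) (sp (n ∸ suc m) m) else 0ℚ) ≡ 0ℚ
    vanish false = refl
    vanish true rewrite ≰⇒≤ᵇ≡false (ℕₚ.<⇒≱ (ℕ.s≤s b≤m)) = Σ-0 (sp (n ∸ suc m) m) (λ _ → refl)

Σ⊑-suc-≥ : ∀ n m b λs h → m ℕ.< b → Σ⊑ n (suc m) (b ∷ λs) h ≡
           Σ⊑ n m (b ∷ λs) h ℚ.+ (if suc m ≤ᵇ n then Σ⊑ (n ∸ suc m) m λs (h ∘ (suc m ∷_)) else 0ℚ)
Σ⊑-suc-≥ n m b λs h m<b = trans (Σ-sp-suc _ n m) (cong (Σ⊑ n m (b ∷ λs) h ℚ.+_) split)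
  where
    split : (if suc m ≤ᵇ n then Σ (λ μ → if (suc m ≤ᵇ b) ∧ (μ ⊑ᵇ λs) then h (suc m ∷ μ) else 0ℚ) (sp (n ∸ suc m) m) else 0ℚ)
          ≡ (if suc m ≤ᵇ n then Σ⊑ (n ∸ suc m) m λs (h ∘ (suc m ∷_)) else 0ℚ)
    split rewrite ≤⇒≤ᵇ≡true m<b = refl

-- A contained μ has first part at most m and its other parts inside λ, so its size is at most m +
-- |λ|.
⋢-large : ∀ {m μ} b λs → StrictBelow m μ → m ℕ.+ size λs ℕ.< size μ → (μ ⊑ᵇ (b ∷ λs)) ≡ false
⋢-large {μ = suc a ∷ μ} b λs (a<m ∷ _) m+λ<μ with suc a ≤ᵇ b | μ ⊑ᵇ λs in μ⊑λ
... | false | _     = refl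
... | true  | false = refl
... | true  | true  = ⊥-elim (ℕₚ.<⇒≱ m+λ<μ (ℕₚ.+-mono-≤ a<m (⊑-size μ λs μ⊑λ)))

Σ⊑-large : ∀ n m b λs h → m ℕ.+ size λs ℕ.< n → Σ⊑ n m (b ∷ λs) h ≡ 0ℚ
Σ⊑-large n m b λs h m+λ<n = Σ-0 (sp n m) vanish
  where
    vanish : ∀ {μ} → μ ∈ sp n m → (if μ ⊑ᵇ (b ∷ λs) then h μ else 0ℚ) ≡ 0ℚ
    vanish {μ} μ∈ with sp-sound n m μ∈
    ... | st , sz rewrite ⋢-large b λs st (subst (m ℕ.+ size λs ℕ.<_) (sym sz) m+λ<n) = refl

-- Only λ itself is left: a smaller first part makes the required size unreachable by `Σ⊑-large`,
-- and the remaining parts follow by induction.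
Σ⊑-same : ∀ m λs h → StrictBelow m λs → Σ⊑ (size λs) m λs h ≡ h λs
Σ⊑-same m       []           h [] = ℚₚ.+-identityʳ (h [])
Σ⊑-same (suc m) (suc a ∷ λs) h (ℕ.s≤s a≤m ∷ st) with ℕₚ.m≤n⇒m<n∨m≡n a≤m
... | inj₁ a<m  = trans (Σ⊑-suc-< (suc a ℕ.+ size λs) m (suc a) λs h a<m) (Σ⊑-same m (suc a ∷ λs) h (a<m ∷ st))
... | inj₂ refl = begin
  Σ⊑ n (suc a) (suc a ∷ λs) h
    ≡⟨ Σ⊑-suc-≥ n a (suc a) λs h ℕₚ.≤-refl ⟩
  Σ⊑ n a (suc a ∷ λs) h ℚ.+ (if suc a ≤ᵇ n then Σ⊑ (n ∸ suc a) a λs (h ∘ (suc a ∷_)) else 0ℚ)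
    ≡⟨ cong₂ ℚ._+_ (Σ⊑-large n a (suc a) λs h ℕₚ.≤-refl) (if-true (≤⇒≤ᵇ≡true {suc a} {n} (ℕₚ.m≤m+n (suc a) (size λs)))) ⟩
  0ℚ ℚ.+ Σ⊑ (n ∸ suc a) a λs (h ∘ (suc a ∷_))
    ≡⟨ ℚₚ.+-identityˡ _ ⟩
  Σ⊑ (n ∸ suc a) a λs (h ∘ (suc a ∷_))
    ≡⟨ cong (λ k → Σ⊑ k a λs (h ∘ (suc a ∷_))) (ℕₚ.m+n∸m≡n (suc a) (size λs)) ⟩
  Σ⊑ (size λs) a λs (h ∘ (suc a ∷_))
    ≡⟨ Σ⊑-same a λs _ st ⟩
  h (suc a ∷ λs) ∎
  where n = suc a ℕ.+ size λs

-- lower a λ h is h((a - 1) ∷ λ) if this is a strict partition (dropping a part 0), else 0.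
lower : ℕ → List ℕ → (List ℕ → ℚ) → ℚ
lower zero          λs       h = 0ℚ
lower (suc zero)    λs       h = h λs
lower (suc (suc b)) []       h = h (suc b ∷ [])
lower (suc (suc b)) (c ∷ λs) h = if c ≤ᵇ b then h (suc b ∷ c ∷ λs) else 0ℚ

-- The counterpart of `d` for functions on lists; `d-tab` identifies the two.
down : (List ℕ → ℚ) → List ℕ → ℚ
down h []       = 0ℚ
down h (a ∷ λs) = down (h ∘ (a ∷_)) λs ℚ.+ lower a λs h

φ-tab : ∀ M h → φ 0 (tab M h) ≡ tab M (λ s → lower (suc M) s h)
φ-tab zero    h = refl
φ-tab (suc b) h = cong₂ node
  (tab-cong-strict b (λ { [] → refl ; (c<b ∷ _) → sym (if-true (≤⇒≤ᵇ≡true c<b)) }))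
  -- Here λ already has the part `suc b`; lowering `suc (suc b)` would repeat it, so the value is 0.
  (sym (trans (tab-cong b (λ s → if-false (≰⇒≤ᵇ≡false {suc b} {b} (ℕₚ.<-irrefl refl)))) (tab-const b 0ℚ)))

d-tab : ∀ M h → d (tab M h) ≡ tab M (down h)
d-tab zero    h = refl
d-tab (suc M) h = cong₂ node (d-tab M h)
  (trans (cong₂ _+_ (d-tab M (h ∘ (suc M ∷_))) (φ-tab M h)) (sym (tab-+ M _ _)))

-- The case of a box taken from the first row: with first part at most m, the size forces it to be m
-- and the other parts to be λ. If λ starts with m as well, no strict partition remains.
Σ⊑-lower : ∀ m λs h → StrictBelow m λs → Σ⊑ (m ℕ.+ size λs) m (suc m ∷ λs) h ≡ lower (suc m) λs h
Σ⊑-lower zero    []       h [] = ℚₚ.+-identityʳ (h [])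
Σ⊑-lower (suc b) λs h st = begin
  Σ⊑ n (suc b) (suc (suc b) ∷ λs) h
    ≡⟨ Σ⊑-suc-≥ n b (suc (suc b)) λs h (ℕₚ.n≤1+n (suc b)) ⟩
  Σ⊑ n b (suc (suc b) ∷ λs) h ℚ.+ (if suc b ≤ᵇ n then Σ⊑ (n ∸ suc b) b λs (h ∘ (suc b ∷_)) else 0ℚ)
    ≡⟨ cong₂ ℚ._+_ (Σ⊑-large n b (suc (suc b)) λs h ℕₚ.≤-refl) (if-true (≤⇒≤ᵇ≡true {suc b} {n} (ℕₚ.m≤m+n (suc b) (size λs)))) ⟩
  0ℚ ℚ.+ Σ⊑ (n ∸ suc b) b λs (h ∘ (suc b ∷_))
    ≡⟨ ℚₚ.+-identityˡ _ ⟩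
  Σ⊑ (n ∸ suc b) b λs (h ∘ (suc b ∷_))
    ≡⟨ cong (λ k → Σ⊑ k b λs (h ∘ (suc b ∷_))) (ℕₚ.m+n∸m≡n (suc b) (size λs)) ⟩
  Σ⊑ (size λs) b λs (h ∘ (suc b ∷_))
    ≡⟨ remaining λs st ⟩
  lower (suc (suc b)) λs h ∎
  where
    n = suc b ℕ.+ size λs
    remaining : ∀ λs → StrictBelow (suc b) λs → Σ⊑ (size λs) b λs (h ∘ (suc b ∷_)) ≡ lower (suc (suc b)) λs h
    remaining [] [] = Σ⊑-same b [] (h ∘ (suc b ∷_)) []
    remaining (suc c ∷ λs) (ℕ.s≤s c≤b ∷ st) with ℕₚ.m≤n⇒m<n∨m≡n c≤b
    ... | inj₁ c<b  rewrite ≤⇒≤ᵇ≡true c<b = Σ⊑-same b (suc c ∷ λs) (h ∘ (suc b ∷_)) (c<b ∷ st)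
    ... | inj₂ refl rewrite ≰⇒≤ᵇ≡false {suc b} {b} (ℕₚ.<-irrefl refl) = Σ⊑-large (suc b ℕ.+ size λs) b (suc b) λs (h ∘ (suc b ∷_)) ℕₚ.≤-refl

-- The sum is split by the first part of μ: either it is smaller than that of λ and the missing box
-- lies in the first row, or it is equal and the box is missing from the tail.
Σ⊑-down : ∀ m n λs h → StrictBelow m λs → size λs ≡ suc n → Σ⊑ n m λs h ≡ down h λs
Σ⊑-down-tail : ∀ a λs h → StrictBelow a λs →
  (if suc a ≤ᵇ a ℕ.+ size λs then Σ⊑ (a ℕ.+ size λs ∸ suc a) a λs h else 0ℚ) ≡ down h λs

Σ⊑-down (suc m) n (suc a ∷ λs) h (ℕ.s≤s a≤m ∷ st) refl with ℕₚ.m≤n⇒m<n∨m≡n a≤m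
... | inj₁ a<m  = trans (Σ⊑-suc-< n m (suc a) λs h a<m) (Σ⊑-down m n (suc a ∷ λs) h (a<m ∷ st) refl)
... | inj₂ refl = begin
  Σ⊑ n (suc a) (suc a ∷ λs) h
    ≡⟨ Σ⊑-suc-≥ n a (suc a) λs h ℕₚ.≤-refl ⟩
  Σ⊑ n a (suc a ∷ λs) h ℚ.+ (if suc a ≤ᵇ n then Σ⊑ (n ∸ suc a) a λs (h ∘ (suc a ∷_)) else 0ℚ)
    ≡⟨ cong₂ ℚ._+_ (Σ⊑-lower a λs h st) (Σ⊑-down-tail a λs (h ∘ (suc a ∷_)) st) ⟩
  lower (suc a) λs h ℚ.+ down (h ∘ (suc a ∷_)) λs
    ≡⟨ ℚₚ.+-comm (lower (suc a) λs h) (down (h ∘ (suc a ∷_)) λs) ⟩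
  down (h ∘ (suc a ∷_)) λs ℚ.+ lower (suc a) λs h ∎

-- An empty tail has no box to lose, and the condition `suc a ≤ᵇ a ℕ.+ 0` fails accordingly.
Σ⊑-down-tail a []           h [] rewrite ≰⇒≤ᵇ≡false {suc a} {a ℕ.+ 0} (ℕₚ.<⇒≱ (ℕ.s≤s (ℕₚ.≤-reflexive (ℕₚ.+-identityʳ a)))) = refl
Σ⊑-down-tail a λs@(suc c ∷ λs′) h st
  rewrite ℕₚ.+-suc a (c ℕ.+ size λs′)
        | ≤⇒≤ᵇ≡true {suc a} {suc (a ℕ.+ (c ℕ.+ size λs′))} (ℕ.s≤s (ℕₚ.m≤m+n a (c ℕ.+ size λs′)))
        | ℕₚ.m+n∸m≡n a (c ℕ.+ size λs′) = Σ⊑-down a (c ℕ.+ size λs′) λs h st refl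

-- The branching rule for g

graded : ℕ → (List ℕ → ℚ) → List ℕ → ℚ
graded n h μ = if size μ ≡ᵇ n then h μ else 0ℚ

gℚ : List ℕ → ℚ
gℚ μ = ℕ→ℚ (g μ)

ℕ→ℚ-sum : ∀ (c : List ℕ → Bool) (h : List ℕ → ℕ) xs → ℕ→ℚ (sum (map (λ μ → if c μ then h μ else 0) xs)) ≡ Σ (λ μ → if c μ then ℕ→ℚ (h μ) else 0ℚ) xs
ℕ→ℚ-sum c h []       = refl
ℕ→ℚ-sum c h (μ ∷ xs) = trans (ℕ→ℚ-+ (if c μ then h μ else 0) (sum (map (λ ν → if c ν then h ν else 0) xs))) (cong₂ ℚ._+_ (branch (c μ) (h μ)) (ℕ→ℚ-sum c h xs))
  where
    branch : ∀ b k → ℕ→ℚ (if b then k else 0) ≡ (if b then ℕ→ℚ k else 0ℚ)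
    branch false k = refl
    branch true  k = refl

g-rec : ∀ {k} λs → size λs ≡ suc k → gℚ λs ≡ Σ (λ μ → if μ ⊑ᵇ λs then gℚ μ else 0ℚ) (SP k)
g-rec {k} λs sz = begin
  ℕ→ℚ (gAux (size λs) λs)
    ≡⟨ cong (λ n → ℕ→ℚ (gAux n λs)) sz ⟩
  ℕ→ℚ (sum (map (λ μ → if S μ ⊆ᵇ S λs then gAux k μ else 0) (SP k)))
    ≡⟨ ℕ→ℚ-sum (λ μ → S μ ⊆ᵇ S λs) (gAux k) (SP k) ⟩
  Σ (λ μ → if S μ ⊆ᵇ S λs then ℕ→ℚ (gAux k μ) else 0ℚ) (SP k)
    ≡⟨ Σ-cong (SP k) step ⟩
  Σ (λ μ → if μ ⊑ᵇ λs then gℚ μ else 0ℚ) (SP k) ∎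
  where
    step : ∀ {μ} → μ ∈ SP k → (if S μ ⊆ᵇ S λs then ℕ→ℚ (gAux k μ) else 0ℚ) ≡ (if μ ⊑ᵇ λs then gℚ μ else 0ℚ)
    step {μ} μ∈ with sp-sound k k μ∈
    ... | st , sz′ = cong₂ (λ b n → if b then ℕ→ℚ (gAux n μ) else 0ℚ) (S⊆ᵇS λs st) (sym sz′)

down-graded-g : ∀ n {M λs} → StrictBelow M λs → down (graded n gℚ) λs ≡ graded (suc n) gℚ λs
down-graded-g n []                              = refl
down-graded-g n {M} {λs@(suc a ∷ λs′)} st@(_ ∷ _) = begin
  down (graded n gℚ) λs
    -- The bound `M ℕ.+ k` is at least M, so it bounds the parts of λ, and at least k, so that
    -- `sp-stable` applies.
    ≡⟨ Σ⊑-down (M ℕ.+ k) k λs (graded n gℚ) (weaken (ℕₚ.m≤m+n M k) st) refl ⟨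
  Σ (λ μ → if μ ⊑ᵇ λs then graded n gℚ μ else 0ℚ) (sp k (M ℕ.+ k))
    ≡⟨ cong (Σ _) (sp-stable k M) ⟩
  Σ (λ μ → if μ ⊑ᵇ λs then graded n gℚ μ else 0ℚ) (SP k)
    ≡⟨ Σ-cong (SP k) (λ {μ} μ∈ → cong (λ z → if μ ⊑ᵇ λs then (if z ≡ᵇ n then gℚ μ else 0ℚ) else 0ℚ) (proj₂ (sp-sound k k μ∈))) ⟩
  Σ (λ μ → if μ ⊑ᵇ λs then (if k ≡ᵇ n then gℚ μ else 0ℚ) else 0ℚ) (SP k)
    ≡⟨ pull (k ≡ᵇ n) ⟩
  (if k ≡ᵇ n then gℚ λs else 0ℚ) ∎
  where
    k = a ℕ.+ size λs′
    pull : ∀ b → Σ (λ μ → if μ ⊑ᵇ λs then (if b then gℚ μ else 0ℚ) else 0ℚ) (SP k) ≡ (if b then gℚ λs else 0ℚ)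
    pull true  = sym (g-rec λs refl)
    pull false = Σ-0 (SP k) (λ {μ} _ → Boolₚ.if-eta (μ ⊑ᵇ λs))

δ-tab : ∀ M → δ M ≡ tab M (graded 0 gℚ)
δ-tab zero    = refl
δ-tab (suc M) = cong₂ node (δ-tab M) (sym (tab-const M 0ℚ))

γ-tab : ∀ M n → γ M n ≡ tab M (graded n gℚ)
γ-tab M zero    = δ-tab M
γ-tab M (suc n) = begin
  d (γ M n)                    ≡⟨ cong d (γ-tab M n) ⟩
  d (tab M (graded n gℚ))      ≡⟨ d-tab M (graded n gℚ) ⟩
  tab M (down (graded n gℚ))   ≡⟨ tab-cong-strict M (down-graded-g n) ⟩
  tab M (graded (suc n) gℚ)    ∎

-- The weight 2^(|λ| - ℓ(λ)) is a product over the parts a of 2^(a - 1).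
⟪_,_⟫ : ∀ {M} → V M → V M → ℚ
⟪ leaf a , leaf b ⟫               = a ℚ.* b
⟪ node {M} F G , node H K ⟫       = ⟪ F , H ⟫ ℚ.+ ℕ→ℚ (2 ℕ.^ M) ℚ.* ⟪ G , K ⟫

⟪⟫-+ˡ : ∀ {M} (F G H : V M) → ⟪ F + G , H ⟫ ≡ ⟪ F , H ⟫ ℚ.+ ⟪ G , H ⟫
⟪⟫-+ˡ (leaf a) (leaf b) (leaf c) = ℚₚ.*-distribʳ-+ c a b
⟪⟫-+ˡ (node {M} F F′) (node G G′) (node H H′) =
  trans (cong₂ (λ x y → x ℚ.+ ℕ→ℚ (2 ℕ.^ M) ℚ.* y) (⟪⟫-+ˡ F G H) (⟪⟫-+ˡ F′ G′ H′))
    (solve 5 (λ a b w x y → (a :+ b) :+ w :* (x :+ y) := (a :+ w :* x) :+ (b :+ w :* y)) refl ⟪ F , H ⟫ ⟪ G , H ⟫ (ℕ→ℚ (2 ℕ.^ M)) ⟪ F′ , H′ ⟫ ⟪ G′ , H′ ⟫)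
  where open ℚS

⟪⟫-comm : ∀ {M} (F G : V M) → ⟪ F , G ⟫ ≡ ⟪ G , F ⟫
⟪⟫-comm (leaf a) (leaf b) = ℚₚ.*-comm a b
⟪⟫-comm (node {M} F F′) (node G G′) = cong₂ (λ x y → x ℚ.+ ℕ→ℚ (2 ℕ.^ M) ℚ.* y) (⟪⟫-comm F G) (⟪⟫-comm F′ G′)

⟪⟫-+ʳ : ∀ {M} (F G H : V M) → ⟪ F , G + H ⟫ ≡ ⟪ F , G ⟫ ℚ.+ ⟪ F , H ⟫
⟪⟫-+ʳ F G H = trans (⟪⟫-comm F (G + H)) (trans (⟪⟫-+ˡ G H F) (cong₂ ℚ._+_ (⟪⟫-comm G F) (⟪⟫-comm H F)))

⟪0,⟫ : ∀ {M} (F : V M) → ⟪ 0# , F ⟫ ≡ 0ℚ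
⟪0,⟫ (leaf a) = ℚₚ.*-zeroˡ a
⟪0,⟫ (node {M} F G) = trans (cong₂ (λ x y → x ℚ.+ ℕ→ℚ (2 ℕ.^ M) ℚ.* y) (⟪0,⟫ F) (⟪0,⟫ G))
  (trans (ℚₚ.+-identityˡ _) (ℚₚ.*-zeroʳ (ℕ→ℚ (2 ℕ.^ M))))

⟪⟫-·ʳ : ∀ {M} c (F G : V M) → ⟪ F , c · G ⟫ ≡ c ℚ.* ⟪ F , G ⟫
⟪⟫-·ʳ c (leaf a) (leaf b) = solve 3 (λ a b c → a :* (c :* b) := c :* (a :* b)) refl a b c
  where open ℚS
⟪⟫-·ʳ c (node {M} F F′) (node G G′) =
  trans (cong₂ (λ x y → x ℚ.+ ℕ→ℚ (2 ℕ.^ M) ℚ.* y) (⟪⟫-·ʳ c F G) (⟪⟫-·ʳ c F′ G′))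
    (solve 4 (λ c x w y → c :* x :+ w :* (c :* y) := c :* (x :+ w :* y)) refl c ⟪ F , G ⟫ (ℕ→ℚ (2 ℕ.^ M)) ⟪ F′ , G′ ⟫)
  where open ℚS

-- The factor 2^M is the weight of the part M + 1 that is being lowered. Split as 2 times the weight
-- of M, it produces the 2 in `φᵀ`.
φ-adjoint : ∀ {M} (F G : V M) → ℕ→ℚ (2 ℕ.^ M) ℚ.* ⟪ φ 0 F , G ⟫ ≡ ⟪ F , φᵀ G ⟫
φ-adjoint (leaf a) (leaf b) = ℚₚ.*-identityˡ (a ℚ.* b)
φ-adjoint {suc M} (node F G) (node H K) = begin
  ℕ→ℚ (2 ℕ.^ suc M) ℚ.* (⟪ G , H ⟫ ℚ.+ W ℚ.* ⟪ 0# , K ⟫)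
    ≡⟨ cong₂ (λ w z → w ℚ.* (⟪ G , H ⟫ ℚ.+ W ℚ.* z)) (ℕ→ℚ-* 2 (2 ℕ.^ M)) (⟪0,⟫ K) ⟩
  (2ℚ ℚ.* W) ℚ.* (⟪ G , H ⟫ ℚ.+ W ℚ.* 0ℚ)
    ≡⟨ solve 2 (λ w x → (con 2ℚ :* w) :* (x :+ w :* con 0ℚ) := con 0ℚ :+ w :* (con 2ℚ :* x)) refl W ⟪ G , H ⟫ ⟩
  0ℚ ℚ.+ W ℚ.* (2ℚ ℚ.* ⟪ G , H ⟫)
    ≡⟨ cong₂ (λ a b → a ℚ.+ W ℚ.* b) (trans (⟪⟫-comm F 0#) (⟪0,⟫ F)) (⟪⟫-·ʳ 2ℚ G H) ⟨
  ⟪ F , 0# ⟫ ℚ.+ W ℚ.* ⟪ G , 2ℚ · H ⟫ ∎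
  where
    open ℚS
    W = ℕ→ℚ (2 ℕ.^ M)

d-adjoint : ∀ {M} (F G : V M) → ⟪ d F , G ⟫ ≡ ⟪ F , u G ⟫
d-adjoint (leaf a) (leaf b) = trans (ℚₚ.*-zeroˡ b) (sym (ℚₚ.*-zeroʳ a))
d-adjoint {suc M} (node F G) (node H K) = begin
  ⟪ d F , H ⟫ ℚ.+ W ℚ.* ⟪ d G + φ 0 F , K ⟫
    ≡⟨ cong (λ z → ⟪ d F , H ⟫ ℚ.+ W ℚ.* z) (⟪⟫-+ˡ (d G) (φ 0 F) K) ⟩
  ⟪ d F , H ⟫ ℚ.+ W ℚ.* (⟪ d G , K ⟫ ℚ.+ ⟪ φ 0 F , K ⟫)
    ≡⟨ solve 4 (λ a w b c → a :+ w :* (b :+ c) := (a :+ w :* c) :+ w :* b) refl ⟪ d F , H ⟫ W ⟪ d G , K ⟫ ⟪ φ 0 F , K ⟫ ⟩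
  (⟪ d F , H ⟫ ℚ.+ W ℚ.* ⟪ φ 0 F , K ⟫) ℚ.+ W ℚ.* ⟪ d G , K ⟫
    ≡⟨ cong₂ (λ a b → a ℚ.+ W ℚ.* b) (cong₂ ℚ._+_ (d-adjoint F H) (φ-adjoint F K)) (d-adjoint G K) ⟩
  (⟪ F , u H ⟫ ℚ.+ ⟪ F , φᵀ K ⟫) ℚ.+ W ℚ.* ⟪ G , u K ⟫
    ≡⟨ cong (ℚ._+ W ℚ.* ⟪ G , u K ⟫) (⟪⟫-+ʳ F (u H) (φᵀ K)) ⟨
  ⟪ F , u H + φᵀ K ⟫ ℚ.+ W ℚ.* ⟪ G , u K ⟫ ∎
  where
    open ℚS
    W = ℕ→ℚ (2 ℕ.^ M)

vac-δ : ∀ {M} (F : V M) → ⟪ δ M , F ⟫ ≡ vac F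
vac-δ (leaf a) = ℚₚ.*-identityˡ a
vac-δ (node {M} F G) = trans (cong₂ (λ x y → x ℚ.+ ℕ→ℚ (2 ℕ.^ M) ℚ.* y) (vac-δ F) (⟪0,⟫ G))
  (solve 2 (λ x w → x :+ w :* con 0ℚ := x) refl (vac F) (ℕ→ℚ (2 ℕ.^ M)))
  where open ℚS

⟪γ,⟫ : ∀ {M} n (F : V M) → ⟪ γ M n , F ⟫ ≡ ε n F
⟪γ,⟫ zero    F = vac-δ F
⟪γ,⟫ {M} (suc n) F = trans (d-adjoint (γ M n) F) (⟪γ,⟫ n (u F))

wt : List ℕ → ℚ
wt []       = 1ℚ
wt (a ∷ λs) = ℕ→ℚ (2 ℕ.^ (a ∸ 1)) ℚ.* wt λs

-- The recursion of the pairing over nodes matches that of `sp` over the largest part; the top half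
-- contributes only if M + 1 is at most n.
⟪tab⟫ : ∀ M n a f → ⟪ tab M (graded n a) , tab M f ⟫ ≡ Σ (λ λs → wt λs ℚ.* (a λs ℚ.* f λs)) (sp n M)
⟪tab⟫ zero    zero    a f = solve 1 (λ x → x := con 1ℚ :* x :+ con 0ℚ) refl (a [] ℚ.* f [])
  where open ℚS
⟪tab⟫ zero    (suc n) a f = ℚₚ.*-zeroˡ (f [])
⟪tab⟫ (suc M) n       a f = trans (cong₂ ℚ._+_ (⟪tab⟫ M n a f) top) (sym (Σ-sp-suc (λ λs → wt λs ℚ.* (a λs ℚ.* f λs)) n M))
  where
    W = ℕ→ℚ (2 ℕ.^ M)
    a′ f′ : List ℕ → ℚ
    a′ = a ∘ (suc M ∷_)
    f′ = f ∘ (suc M ∷_)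
    top : W ℚ.* ⟪ tab M (λ s → graded n a (suc M ∷ s)) , tab M f′ ⟫
        ≡ (if suc M ≤ᵇ n then Σ (λ λs → (W ℚ.* wt λs) ℚ.* (a′ λs ℚ.* f′ λs)) (sp (n ∸ suc M) M) else 0ℚ)
    top with suc M ℕₚ.≤? n
    ... | no M≮n rewrite ≰⇒≤ᵇ≡false M≮n = begin
      W ℚ.* ⟪ tab M (λ s → graded n a (suc M ∷ s)) , tab M f′ ⟫
        ≡⟨ cong (λ z → W ℚ.* ⟪ z , tab M f′ ⟫) (trans (tab-cong M (λ s → cong (if_then a′ s else 0ℚ) (≢⇒≡ᵇ≡false (λ eq → M≮n (subst (suc M ℕ.≤_) eq (ℕₚ.m≤m+n (suc M) (size s))))))) (tab-const M 0ℚ)) ⟩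
      W ℚ.* ⟪ 0# , tab M f′ ⟫   ≡⟨ cong (W ℚ.*_) (⟪0,⟫ (tab M f′)) ⟩
      W ℚ.* 0ℚ                  ≡⟨ ℚₚ.*-zeroʳ W ⟩
      0ℚ                        ∎
    ... | yes M<n rewrite ≤⇒≤ᵇ≡true M<n = begin
      W ℚ.* ⟪ tab M (λ s → graded n a (suc M ∷ s)) , tab M f′ ⟫
        ≡⟨ cong (λ z → W ℚ.* ⟪ z , tab M f′ ⟫) (tab-cong M (λ s → cong (if_then a′ s else 0ℚ) (shift (size s)))) ⟩
      W ℚ.* ⟪ tab M (graded (n ∸ suc M) a′) , tab M f′ ⟫
        ≡⟨ cong (W ℚ.*_) (⟪tab⟫ M (n ∸ suc M) a′ f′) ⟩
      W ℚ.* Σ (λ λs → wt λs ℚ.* (a′ λs ℚ.* f′ λs)) (sp (n ∸ suc M) M)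
        ≡⟨ Σ-*ˡ W _ (sp (n ∸ suc M) M) ⟨
      Σ (λ λs → W ℚ.* (wt λs ℚ.* (a′ λs ℚ.* f′ λs))) (sp (n ∸ suc M) M)
        ≡⟨ Σ-cong (sp (n ∸ suc M) M) (λ {λs} _ → sym (ℚₚ.*-assoc W (wt λs) (a′ λs ℚ.* f′ λs))) ⟩
      Σ (λ λs → (W ℚ.* wt λs) ℚ.* (a′ λs ℚ.* f′ λs)) (sp (n ∸ suc M) M) ∎
      where
        shift : ∀ k → (suc M ℕ.+ k ≡ᵇ n) ≡ (k ≡ᵇ n ∸ suc M)
        shift k with k ℕₚ.≟ n ∸ suc M
        ... | yes refl = trans (≡⇒≡ᵇ≡true {suc M ℕ.+ k} {n} (ℕₚ.m+[n∸m]≡n M<n)) (sym (≡⇒≡ᵇ≡true {k} refl))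
        ... | no k≢    = trans (≢⇒≡ᵇ≡false {suc M ℕ.+ k} {n} (λ eq → k≢ (trans (sym (ℕₚ.m+n∸m≡n (suc M) k)) (cong (_∸ suc M) eq)))) (sym (≢⇒≡ᵇ≡false {k} {n ∸ suc M} k≢))

len≤size : ∀ {m λs} → StrictBelow m λs → len λs ℕ.≤ size λs
len≤size []                       = ℕ.z≤n
len≤size {λs = suc a ∷ _} (_ ∷ st) = ℕ.s≤s (ℕₚ.≤-trans (len≤size st) (ℕₚ.m≤n+m _ a))

wt-strict : ∀ {m λs} → StrictBelow m λs → wt λs ≡ ℕ→ℚ (2 ℕ.^ (size λs ∸ len λs))
wt-strict []                               = refl
wt-strict {λs = suc a ∷ λs} (_ ∷ st) = begin
  ℕ→ℚ (2 ℕ.^ a) ℚ.* wt λs                              ≡⟨ cong (ℕ→ℚ (2 ℕ.^ a) ℚ.*_) (wt-strict st) ⟩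
  ℕ→ℚ (2 ℕ.^ a) ℚ.* ℕ→ℚ (2 ℕ.^ (size λs ∸ len λs))     ≡⟨ ℕ→ℚ-* (2 ℕ.^ a) _ ⟨
  ℕ→ℚ (2 ℕ.^ a ℕ.* 2 ℕ.^ (size λs ∸ len λs))           ≡⟨ cong ℕ→ℚ (ℕₚ.^-distribˡ-+-* 2 a _) ⟨
  ℕ→ℚ (2 ℕ.^ (a ℕ.+ (size λs ∸ len λs)))               ≡⟨ cong (λ k → ℕ→ℚ (2 ℕ.^ k)) (ℕₚ.+-∸-assoc a (len≤size st)) ⟨
  ℕ→ℚ (2 ℕ.^ (a ℕ.+ size λs ∸ len λs))                 ∎

-- Of the two factors g in the weight, one is the visible `γ M n` and the other arises when uⁿ is
-- moved across the pairing as dⁿ. Since n is at most M, the truncated list of partitions is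
-- complete.
𝔼-ε : ∀ f {M} n → n ℕ.≤ M → 𝔼 n f ≡ 1/! n ℚ.* ε n (tab M (evalΓ f) * γ M n)
𝔼-ε f {M} n n≤M = sym (begin
  1/! n ℚ.* ε n (tab M (evalΓ f) * γ M n)
    ≡⟨ cong (1/! n ℚ.*_) (⟪γ,⟫ n _) ⟨
  1/! n ℚ.* ⟪ γ M n , tab M (evalΓ f) * γ M n ⟫
    ≡⟨ cong (λ z → 1/! n ℚ.* ⟪ z , tab M (evalΓ f) * z ⟫) (γ-tab M n) ⟩
  1/! n ℚ.* ⟪ tab M (graded n gℚ) , tab M (evalΓ f) * tab M (graded n gℚ) ⟫
    ≡⟨ cong (λ z → 1/! n ℚ.* ⟪ tab M (graded n gℚ) , z ⟫) (tab-* M (evalΓ f) (graded n gℚ)) ⟨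
  1/! n ℚ.* ⟪ tab M (graded n gℚ) , tab M (λ λs → evalΓ f λs ℚ.* graded n gℚ λs) ⟫
    ≡⟨ cong (1/! n ℚ.*_) (⟪tab⟫ M n gℚ _) ⟩
  1/! n ℚ.* Σ (λ λs → wt λs ℚ.* (gℚ λs ℚ.* (evalΓ f λs ℚ.* graded n gℚ λs))) (sp n M)
    ≡⟨ Σ-*ˡ (1/! n) _ (sp n M) ⟨
  Σ (λ λs → 1/! n ℚ.* (wt λs ℚ.* (gℚ λs ℚ.* (evalΓ f λs ℚ.* graded n gℚ λs)))) (sp n M)
    ≡⟨ cong (Σ _) (trans (cong (sp n) (sym (ℕₚ.m∸n+n≡m n≤M))) (sp-stable n (M ∸ n))) ⟩
  Σ (λ λs → 1/! n ℚ.* (wt λs ℚ.* (gℚ λs ℚ.* (evalΓ f λs ℚ.* graded n gℚ λs)))) (SP n)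
    ≡⟨ Σ-cong (SP n) term ⟩
  𝔼 n f ∎)
  where
    term : ∀ {λs} → λs ∈ SP n → 1/! n ℚ.* (wt λs ℚ.* (gℚ λs ℚ.* (evalΓ f λs ℚ.* graded n gℚ λs))) ≡ weight n λs ℚ.* evalΓ f λs
    term {λs} λs∈ with sp-sound n n λs∈
    ... | st , refl = begin
      1/! n ℚ.* (wt λs ℚ.* (gℚ λs ℚ.* (evalΓ f λs ℚ.* graded n gℚ λs)))
        ≡⟨ cong₂ (λ w b → 1/! n ℚ.* (w ℚ.* (gℚ λs ℚ.* (evalΓ f λs ℚ.* (if b then gℚ λs else 0ℚ))))) (wt-strict st) (≡⇒≡ᵇ≡true {n} refl) ⟩
      1/! n ℚ.* (P ℚ.* (gℚ λs ℚ.* (evalΓ f λs ℚ.* gℚ λs)))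
        ≡⟨ solve 4 (λ i p g e → i :* (p :* (g :* (e :* g))) := ((p :* (g :* g)) :* i) :* e) refl (1/! n) P (gℚ λs) (evalΓ f λs) ⟩
      ((P ℚ.* (gℚ λs ℚ.* gℚ λs)) ℚ.* 1/! n) ℚ.* evalΓ f λs
        ≡⟨ cong (λ z → (z ℚ.* 1/! n) ℚ.* evalΓ f λs) (trans (ℕ→ℚ-* (2 ℕ.^ (n ∸ len λs)) (g λs ℕ.* g λs)) (cong (P ℚ.*_) (ℕ→ℚ-* (g λs) (g λs)))) ⟨
      (ℕ→ℚ (2 ℕ.^ (n ∸ len λs) ℕ.* (g λs ℕ.* g λs)) ℚ.* 1/! n) ℚ.* evalΓ f λs
        ≡⟨ cong (ℚ._* evalΓ f λs) (/-as-* (+ (2 ℕ.^ (n ∸ len λs) ℕ.* (g λs ℕ.* g λs))) (n ℕ.!) {{n ℕₚ.!≢0}}) ⟨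
      weight n λs ℚ.* evalΓ f λs ∎
      where
        open ℚS
        P = ℕ→ℚ (2 ℕ.^ (n ∸ len λs))

theorem1p2 : (f : ΓExpr) → ∃ λ (Φ : List ℚ) → (n : ℕ) → 𝔼 n f ≡ evalPoly Φ (ℕ→ℚ n)
theorem1p2 f = Δ-vanishing⇒polynomial (nilBound f) (λ n → 𝔼 n f) (λ n →
  -- The truncation may depend on n, as the differences are shown to vanish one n at a time; this M
  -- is the least one that `Δ-ε` accepts at offset 0.
  let M = nilBound f ℕ.+ (n ℕ.+ 0) in
  Δ-ε (nilBound f) (Nil-evalΓ f M) 0 (λ n → 𝔼 n f)
    (λ m m≤M → subst (λ j → 𝔼 m f ≡ 1/! j ℚ.* ε j (tab M (evalΓ f) * γ M m)) (sym (ℕₚ.+-identityʳ m))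
                 (𝔼-ε f m (subst (ℕ._≤ M) (ℕₚ.+-identityʳ m) m≤M)))
    n ℕₚ.≤-refl)
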